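{- Let $\mathscr{C}$ be a cartesian closed $\infty$-category and let $K\in\mathscr{C}$ be a Kan complex that is reflexive via morphisms $F:K\to[K\Rightarrow K]$ and $G:[K\Rightarrow K]\to K$ (so $FG\simeq \mathrm{id}_{[K\Rightarrow K]}$) and that has enough points. Define $a\bullet b=F(a)(b)$ for vertices $a,b$ of $K$, and define the interpretation $[\![\,\cdot\,]\!]_\rho$ of $\lambda$-terms, for each assignment $\rho:Var\to|K|$, by induction: $[\![x]\!]_\rho=\rho(x)$, $[\![MN]\!]_\rho=[\![M]\!]_\rho\bullet[\![N]\!]_\rho$, and $[\![\lambda x.M]\!]_\rho=G(\boldsymbol{\lambda}d.[\![M]\!]_{[d/x]\rho})$, where $\boldsymbol{\lambda}d.[\![M]\!]_{[d/x]\rho}$ denotes the vertex of $[K\Rightarrow K]$ (a map $\Delta^0\to[K\Rightarrow K]$) given by $d\mapsto[\![M]\!]_{[d/x]\rho}$. Let $\mathfrak{M}=\langle K,\bullet,[\![\,\cdot\,]\!]\rangle$. Then: (1) $\mathfrak{M}$ is a homotopic $\lambda$-model; (2) $\mathfrak{M}$ is extensional if and only if $GF\simeq\mathrm{id}_K$.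
   Context: $\mathscr{C}$ is an $\infty$-category embedded in the $\infty$-category $CAT_\infty$ of $\infty$-categories. It is cartesian closed if for all objects $A,B$ there is an object $A\times B$ in $\mathscr{C}$ and an object $[A\Rightarrow B]$ in $\mathscr{C}$ with equivalences $Hom_{\mathscr{C}}(A\times B,C)\simeq Hom_{\mathscr{C}}(A,[B\Rightarrow C])$. An object $K$ is reflexive if $[K\Rightarrow K]$ is a weak retract of $K$: there are morphisms $F:K\to[K\Rightarrow K]$, $G:[K\Rightarrow K]\to K$ with $FG\simeq\mathrm{id}_{[K\Rightarrow K]}$. A reflexive Kan complex $K$ has enough points if for any two morphisms $f,g:K\to K$ with $f x\simeq g x$ for every vertex $x:\Delta^0\to K$, one has $f\simeq g$. For a Kan complex $K$, $|K|$ denotes its set of vertices and $a\simeq b$ means that $a,b$ are equivalent (joined by an edge). $[a/x]\rho$ is $\rho$ modified to send $x$ to $a$; $[N/x]M$ is capture-avoiding substitution; $FV(M)$ free variables. A homotopic $\lambda$-model is a triple $\langle K,\bullet,[\![\,\cdot\,]\!]\rangle$ where $K$ is a Kan complex, $\bullet:|K|\times|K|\to|K|$, and $[\![\,\cdot\,]\!]$ assigns to each $\lambda$-term $M$ and assignment $\rho$ a vertex $[\![M]\!]_\rho$ such that: (1) $[\![x]\!]_\rho=\rho(x)$; (2) $[\![MN]\!]_\rho\simeq[\![M]\!]_\rho\bullet[\![N]\!]_\rho$; (3) $[\![\lambda x.M]\!]_\rho\bullet a\simeq[\![M]\!]_{[a/x]\rho}$ for all $a\in|K|$; (4) $[\![M]\!]_\rho=[\![M]\!]_\sigma$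 whenever $\rho,\sigma$ agree on $FV(M)$; (5) $[\![\lambda x.M]\!]_\rho\simeq[\![\lambda y.[y/x]M]\!]_\rho$ if $y\notin FV(M)$; (6) if $[\![M]\!]_{[a/x]\rho}\simeq[\![N]\!]_{[a/x]\rho}$ for all $a\in|K|$ then $[\![\lambda x.M]\!]_\rho\simeq[\![\lambda x.N]\!]_\rho$. It is extensional if moreover $[\![\lambda x.Mx]\!]_\rho\simeq[\![M]\!]_\rho$ whenever $x\notin FV(M)$. -}

module Defs where

open import Data.Bool.Base using (if_then_else_)
open import Data.Fin.Base as Fin using (Fin; toℕ; punchIn)
open import Data.Fin.Patterns using (0F; 1F; 2F)
open import Data.Fin.Properties using (≤-poset; punchIn-mono-≤)
import Data.Fin.Properties as Fin
open import Data.List.Base using (List; []; _∷_; _++_; filter; foldr; concatMap)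
open import Data.List.Membership.DecPropositional using () renaming (_∈?_ to mem?)
open import Data.List.Membership.Propositional using (_∈_; _∉_)
open import Data.Nat.Base using (ℕ; suc; _<_; _⊔_)
open import Data.Nat.Properties using (_≟_)
open import Data.Product.Base using (Σ; Σ-syntax; ∃-syntax; _×_; _,_; proj₁; proj₂)
open import Data.Product.Relation.Binary.Pointwise.NonDependent using (×-setoid)
open import Function.Base using (_∘′_)
open import Level using (Level; 0ℓ; Lift; lift; lower) renaming (_⊔_ to _⊔ˡ_; suc to sucˡ)
open import Relation.Binary.Bundles using (Setoid)
open import Relation.Binary.Morphism.Bundles using (PosetHomomorphism)
import Relation.Binary.Morphism.Construct.Composition as Composition
import Relation.Binary.Morphism.Construct.Identity as Identity
import Relation.Binary.Construct.On as On
open import Relation.Binary.PropositionalEquality.Core as ≡ using (_≡_; _≢_)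
open import Relation.Nullary.Decidable using (does; ¬?)

private
  variable
    c e c′ e′ c″ e″ p q : Level

----------------------------------------------------------------------
-- Simplicial sets

-- The simplex category: [m] = {0 < … < m} is carried by Fin (suc m).
infix 4 _⇢_
_⇢_ : ℕ → ℕ → Set
m ⇢ n = PosetHomomorphism (≤-poset (suc m)) (≤-poset (suc n))

module Mono {m n : ℕ} (α : m ⇢ n) = PosetHomomorphism α

infix 4 _≗_
_≗_ : ∀ {m n} → m ⇢ n → m ⇢ n → Set
α ≗ β = ∀ i → Mono.⟦_⟧ α i ≡ Mono.⟦_⟧ β i

idₘ : ∀ {n} → n ⇢ n
idₘ {n} = Identity.posetHomomorphism (≤-poset (suc n))

infixr 9 _∘ₘ_
_∘ₘ_ : ∀ {l m n} → m ⇢ n → l ⇢ m → l ⇢ n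
β ∘ₘ α = Composition.posetHomomorphism α β

monotone : ∀ {m n} (f : Fin (suc m) → Fin (suc n)) → (∀ {i j} → i Fin.≤ j → f i Fin.≤ f j) → m ⇢ n
monotone f mono = record { ⟦_⟧ = f ; isOrderHomomorphism = record { cong = ≡.cong f ; mono = mono } }

constₘ : ∀ {m n} → Fin (suc n) → m ⇢ n
constₘ i = monotone (λ _ → i) (λ _ → Fin.≤-refl)

δ : ∀ {n} → Fin (suc (suc n)) → n ⇢ suc n
δ i = monotone (punchIn i) (λ {j} {k} → punchIn-mono-≤ i j k)

-- Sets are setoids, so that function complexes can be formed without
-- function extensionality; "=" between simplices is _≈_ throughout.
record SSet c e : Set (sucˡ (c ⊔ˡ e)) where
  no-eta-equality
  field
    simplices : ℕ → Setoid c e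

  Simplex : ℕ → Set c
  Simplex n = Setoid.Carrier (simplices n)

  infix 4 _≈_
  _≈_ : ∀ {n} → Simplex n → Simplex n → Set e
  _≈_ {n} = Setoid._≈_ (simplices n)

  field
    act      : ∀ {m n} → m ⇢ n → Simplex n → Simplex m
    act-cong : ∀ {m n} {α β : m ⇢ n} {x y : Simplex n} → α ≗ β → x ≈ y → act α x ≈ act β y
    act-id   : ∀ {n} (x : Simplex n) → act idₘ x ≈ x
    act-∘    : ∀ {l m n} (β : m ⇢ n) (α : l ⇢ m) (x : Simplex n) → act (β ∘ₘ α) x ≈ act α (act β x)

  face : ∀ {n} → Fin (suc (suc n)) → Simplex (suc n) → Simplex n
  face i = act (δ i)

  source target : Simplex 1 → Simplex 0
  source = face 1F
  target = face 0F

  degenerate : ∀ {n} → Simplex 0 → Simplex n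
  degenerate = act (constₘ 0F)

  module Eq {n} = Setoid (simplices n)

  act-congʳ : ∀ {m n} (α : m ⇢ n) {x y : Simplex n} → x ≈ y → act α x ≈ act α y
  act-congʳ α = act-cong {α = α} (λ _ → ≡.refl)

∣_∣ : SSet c e → Set c
∣ X ∣ = SSet.Simplex X 0

infix 4 _⟶_
record _⟶_ (X : SSet c e) (Y : SSet c′ e′) : Set (c ⊔ˡ e ⊔ˡ c′ ⊔ˡ e′) where
  no-eta-equality
  private
    module X = SSet X
    module Y = SSet Y
  field
    fun     : ∀ {n} → X.Simplex n → Y.Simplex n
    cong    : ∀ {n} {x y : X.Simplex n} → x X.≈ y → fun x Y.≈ fun y
    natural : ∀ {m n} (α : m ⇢ n) (x : X.Simplex n) → fun (X.act α x) Y.≈ Y.act α (fun x)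

open _⟶_ public

module _ {X : SSet c e} where

  idˢ : X ⟶ X
  fun     idˢ x   = x
  cong    idˢ x≈y = x≈y
  natural idˢ _ _ = SSet.Eq.refl X

module _ {X : SSet c e} {Y : SSet c′ e′} {Z : SSet c″ e″} where

  infixr 9 _∘ˢ_
  _∘ˢ_ : Y ⟶ Z → X ⟶ Y → X ⟶ Z
  fun     (g ∘ˢ f) x   = fun g (fun f x)
  cong    (g ∘ˢ f) x≈y = cong g (cong f x≈y)
  natural (g ∘ˢ f) α x = SSet.Eq.trans Z (cong g (natural f α x)) (natural g α (fun f x))

module _ (X : SSet c e) (Y : SSet c′ e′) where
  private
    module X = SSet X
    module Y = SSet Y

  infixr 5 _×ˢ_
  _×ˢ_ : SSet (c ⊔ˡ c′) (e ⊔ˡ e′)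
  SSet.simplices _×ˢ_ n                 = ×-setoid (X.simplices n) (Y.simplices n)
  SSet.act       _×ˢ_ α (x , y)         = X.act α x , Y.act α y
  SSet.act-cong  _×ˢ_ α≗β (x≈x′ , y≈y′) = X.act-cong α≗β x≈x′ , Y.act-cong α≗β y≈y′
  SSet.act-id    _×ˢ_ (x , y)           = X.act-id x , Y.act-id y
  SSet.act-∘     _×ˢ_ β α (x , y)       = X.act-∘ β α x , Y.act-∘ β α y

module _ {X : SSet c e} {Y : SSet c′ e′} where
  private
    module X = SSet X
    module Y = SSet Y

  fstˢ : X ×ˢ Y ⟶ X
  fun     fstˢ     = proj₁
  cong    fstˢ     = proj₁
  natural fstˢ _ _ = X.Eq.refl

  sndˢ : X ×ˢ Y ⟶ Y
  fun     sndˢ     = proj₂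
  cong    sndˢ     = proj₂
  natural sndˢ _ _ = Y.Eq.refl

  ⟨_,_⟩ˢ : {W : SSet c″ e″} → W ⟶ X → W ⟶ Y → W ⟶ X ×ˢ Y
  fun     ⟨ f , g ⟩ˢ w   = fun f w , fun g w
  cong    ⟨ f , g ⟩ˢ w≈v = cong f w≈v , cong g w≈v
  natural ⟨ f , g ⟩ˢ α w = natural f α w , natural g α w

  constˢ : ∣ Y ∣ → X ⟶ Y
  fun     (constˢ y) _   = Y.degenerate y
  cong    (constˢ y) _   = Y.Eq.refl
  natural (constˢ y) α _ = Y.Eq.trans (Y.act-cong (λ _ → ≡.refl) Y.Eq.refl) (Y.act-∘ (constₘ 0F) α y)

----------------------------------------------------------------------
-- Simplices, horns, Kan complexes and ∞-categories

Δ : ℕ → SSet c e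
Setoid.Carrier (SSet.simplices (Δ {c} {e} n) m)         = Lift c (m ⇢ n)
Setoid._≈_ (SSet.simplices (Δ {c} {e} n) m) α β         = Lift e (lower α ≗ lower β)
Setoid.isEquivalence (SSet.simplices (Δ {c} {e} n) m)   = record
  { refl  = lift λ _ → ≡.refl
  ; sym   = λ p → lift λ i → ≡.sym (lower p i)
  ; trans = λ p q → lift λ i → ≡.trans (lower p i) (lower q i)
  }
SSet.act (Δ n) α β                                      = lift (lower β ∘ₘ α)
SSet.act-cong (Δ n) {x = β} p q                         = lift λ i →
  ≡.trans (≡.cong (Mono.⟦_⟧ (lower β)) (p i)) (lower q _)
SSet.act-id (Δ n) _                                     = lift λ _ → ≡.refl
SSet.act-∘ (Δ n) _ _ _                                  = lift λ _ → ≡.refl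

-- Δ[ n ], at the lowest level.
Δ[_] : ℕ → SSet 0ℓ 0ℓ
Δ[ n ] = Δ n

-- Λ[ n , i ] consists of the α : [m] → [n] missing some j ≢ i.
Λ[_,_] : (n : ℕ) → Fin (suc n) → SSet 0ℓ 0ℓ
SSet.simplices Λ[ n , i ] m = On.setoid (SSet.simplices Δ[ n ] m)
  (proj₁ {B = λ α → ∃[ j ] j ≢ i × (∀ k → Mono.⟦_⟧ (lower α) k ≢ j)})
SSet.act Λ[ n , i ] α (β , j , j≢i , avoids) = SSet.act Δ[ n ] α β , j , j≢i , λ k → avoids (Mono.⟦_⟧ α k)
SSet.act-cong Λ[ n , i ] {α = α} {β} {x} {y} = SSet.act-cong Δ[ n ] {α = α} {β} {proj₁ x} {proj₁ y}
SSet.act-id Λ[ n , i ] x             = SSet.act-id Δ[ n ] (proj₁ x)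
SSet.act-∘ Λ[ n , i ] β α x          = SSet.act-∘ Δ[ n ] β α (proj₁ x)

hornInclusion : ∀ {n i} → Λ[ n , i ] ⟶ Δ[ n ]
fun     hornInclusion     = proj₁
cong    hornInclusion p   = p
natural hornInclusion _ _ = lift λ _ → ≡.refl

HornsFill : SSet c e → (n : ℕ) → Fin (suc n) → Set (c ⊔ˡ e)
HornsFill X n i = (h : Λ[ n , i ] ⟶ X) →
  Σ[ s ∈ Δ[ n ] ⟶ X ] (∀ {m} (x : SSet.Simplex Λ[ n , i ] m) →
    SSet._≈_ X (fun (s ∘ˢ hornInclusion) x) (fun h x))

IsKan : SSet c e → Set (c ⊔ˡ e)
IsKan X = ∀ n (i : Fin (suc (suc n))) → HornsFill X (suc n) i

IsQuasiCategory : SSet c e → Set (c ⊔ˡ e)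
IsQuasiCategory X = ∀ n (i : Fin (suc n)) → 0 < toℕ i → toℕ i < n → HornsFill X n i

infix 4 [_]_≃_
record [_]_≃_ (X : SSet c e) (x y : ∣ X ∣) : Set (c ⊔ˡ e) where
  constructor joinedBy
  open SSet X
  field
    edge       : Simplex 1
    edgeSource : source edge ≈ x
    edgeTarget : target edge ≈ y

-- f has an inverse in the homotopy category: 2-simplices σ and τ
-- witness g ∘ f = id and f ∘ g = id.
IsEquivalenceEdge : (X : SSet c e) → SSet.Simplex X 1 → Set (c ⊔ˡ e)
IsEquivalenceEdge X f = ∃[ g ]
    (∃[ σ ] face 2F σ ≈ f × face 0F σ ≈ g × face 1F σ ≈ degenerate (source f))
  × (∃[ τ ] face 2F τ ≈ g × face 0F τ ≈ f × face 1F τ ≈ degenerate (target f))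
  where open SSet X

module _ (X : SSet c e) where
  open SSet X

  equivalence-resp : ∀ {f f′} → f ≈ f′ → IsEquivalenceEdge X f → IsEquivalenceEdge X f′
  equivalence-resp {f} {f′} f≈f′ (g , (σ , σ₂ , σ₀ , σ₁) , (τ , τ₂ , τ₀ , τ₁)) = g
    , (σ , Eq.trans σ₂ f≈f′ , σ₀ , Eq.trans σ₁ (degenerate-face 1F))
    , (τ , τ₂ , Eq.trans τ₀ f≈f′ , Eq.trans τ₁ (degenerate-face 0F))
    where
    degenerate-face : (i : Fin 2) → degenerate {1} (face i f) ≈ degenerate (face i f′)
    degenerate-face i = act-congʳ (constₘ 0F) (act-congʳ (δ i) f≈f′)

  act-degenerate : ∀ {m n} (α : m ⇢ n) x → act α (degenerate x) ≈ degenerate x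
  act-degenerate α x = Eq.trans (Eq.sym (act-∘ (constₘ 0F) α x)) (act-cong (λ _ → ≡.refl) Eq.refl)

  degenerate₀ : ∀ x → degenerate {0} x ≈ x
  degenerate₀ x = Eq.trans (act-cong (λ { 0F → ≡.refl ; (Fin.suc ()) }) Eq.refl) (act-id x)

  degenerate-equivalence : ∀ x → IsEquivalenceEdge X (degenerate x)
  degenerate-equivalence x = degenerate x
    , (degenerate x , act-degenerate _ x , act-degenerate _ x , Eq.trans (act-degenerate _ x) (lemma 1F))
    , (degenerate x , act-degenerate _ x , act-degenerate _ x , Eq.trans (act-degenerate _ x) (lemma 0F))
    where
    lemma : ∀ i → degenerate {1} x ≈ degenerate (face i (degenerate x))
    lemma i = act-congʳ (constₘ 0F) (Eq.sym (Eq.trans (act-degenerate (δ i) x) (degenerate₀ x)))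

  ≈⇒≃ : ∀ {x y} → x ≈ y → [ X ] x ≃ y
  ≈⇒≃ {x} x≈y = joinedBy (degenerate x)
    (Eq.trans (act-degenerate _ x) (degenerate₀ x))
    (Eq.trans (Eq.trans (act-degenerate _ x) (degenerate₀ x)) x≈y)

map-equivalence : {X : SSet c e} {Y : SSet c′ e′} (h : X ⟶ Y) {f : SSet.Simplex X 1} →
  IsEquivalenceEdge X f → IsEquivalenceEdge Y (fun h f)
map-equivalence {X = X} {Y = Y} h {f} (g , (σ , σ₂ , σ₀ , σ₁) , (τ , τ₂ , τ₀ , τ₁)) = fun h g
  , (fun h σ , push 2F σ₂ , push 0F σ₀ , Y.Eq.trans (push 1F σ₁) (degenerate-face 1F))
  , (fun h τ , push 2F τ₂ , push 0F τ₀ , Y.Eq.trans (push 1F τ₁) (degenerate-face 0F))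
  where
  module X = SSet X
  module Y = SSet Y
  push : ∀ {n} (i : Fin (suc (suc n))) {x y} → X.face i x X.≈ y → Y.face i (fun h x) Y.≈ fun h y
  push i p = Y.Eq.trans (Y.Eq.sym (natural h (δ i) _)) (cong h p)
  degenerate-face : (i : Fin 2) → fun h (X.degenerate {1} (X.face i f)) Y.≈ Y.degenerate (Y.face i (fun h f))
  degenerate-face i = Y.Eq.trans (natural h (constₘ 0F) (X.face i f)) (Y.act-congʳ (constₘ 0F) (natural h (δ i) f))

-- The largest Kan complex contained in an ∞-category.
record CoreSimplex (X : SSet c e) (n : ℕ) : Set (c ⊔ˡ e) where
  constructor _,_
  field
    simplex          : SSet.Simplex X n
    edgesEquivalence : (α : 1 ⇢ n) → IsEquivalenceEdge X (SSet.act X α simplex)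

Core : SSet c e → SSet (c ⊔ˡ e) e
SSet.simplices (Core X) n = On.setoid (SSet.simplices X n) (CoreSimplex.simplex {X = X} {n = n})
SSet.act (Core X) β (x , eqv) =
  SSet.act X β x , λ α → equivalence-resp X (SSet.act-∘ X β α x) (eqv (β ∘ₘ α))
SSet.act-cong (Core X) α≗β x≈y     = SSet.act-cong X α≗β x≈y
SSet.act-id   (Core X) (x , _)     = SSet.act-id X x
SSet.act-∘    (Core X) β α (x , _) = SSet.act-∘ X β α x

coreVertex : (X : SSet c e) → ∣ X ∣ → ∣ Core X ∣
coreVertex X x = x , λ α →
  equivalence-resp X (act-cong (λ i → unique (Mono.⟦_⟧ α i)) Eq.refl) (degenerate-equivalence X x)
  where
  open SSet X
  unique : (j : Fin 1) → 0F ≡ j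
  unique 0F = ≡.refl

module _ {X : SSet c e} {Y : SSet c′ e′} where

  mapCore : X ⟶ Y → Core X ⟶ Core Y
  fun (mapCore h) (x , eqv)     = fun h x , λ α → equivalence-resp Y (natural h α x) (map-equivalence h (eqv α))
  cong (mapCore h) x≈y          = cong h x≈y
  natural (mapCore h) α (x , _) = natural h α x

  pair-equivalence : ∀ {f g} → IsEquivalenceEdge X f → IsEquivalenceEdge Y g →
    IsEquivalenceEdge (X ×ˢ Y) (f , g)
  pair-equivalence (f′ , (σ , σ₂ , σ₀ , σ₁) , (τ , τ₂ , τ₀ , τ₁)) (g′ , (υ , υ₂ , υ₀ , υ₁) , (ω , ω₂ , ω₀ , ω₁)) =
      (f′ , g′)
    , ((σ , υ) , (σ₂ , υ₂) , (σ₀ , υ₀) , (σ₁ , υ₁))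
    , ((τ , ω) , (τ₂ , ω₂) , (τ₀ , ω₀) , (τ₁ , ω₁))

  core-× : Core X ×ˢ Core Y ⟶ Core (X ×ˢ Y)
  fun core-× ((x , eqvx) , (y , eqvy)) = (x , y) , λ α → pair-equivalence (eqvx α) (eqvy α)
  cong core-× x≈y                      = x≈y
  natural core-× _ _                   = SSet.Eq.refl X , SSet.Eq.refl Y

----------------------------------------------------------------------
-- Function complexes

module _ (X : SSet c e) (Y : SSet c′ e′) where
  private
    module X = SSet X
    module Y = SSet Y

  -- The action of α on s : Δ[ n ] × X → Y is s ∘ (α × id).
  Fun-act : ∀ {m n} → m ⇢ n → Δ[ n ] ×ˢ X ⟶ Y → Δ[ m ] ×ˢ X ⟶ Y
  fun     (Fun-act α s) (β , x)   = fun s (lift (α ∘ₘ lower β) , x)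
  cong    (Fun-act α s) (p , q)   = cong s (lift (λ i → ≡.cong (Mono.⟦_⟧ α) (lower p i)) , q)
  natural (Fun-act α s) γ (β , x) = natural s γ (lift (α ∘ₘ lower β) , x)

  Fun : SSet (c ⊔ˡ e ⊔ˡ c′ ⊔ˡ e′) (c ⊔ˡ e′)
  Setoid.Carrier (SSet.simplices Fun n)       = Δ[ n ] ×ˢ X ⟶ Y
  Setoid._≈_ (SSet.simplices Fun n) s t       =
    ∀ {m} (α : SSet.Simplex Δ[ n ] m) (x : X.Simplex m) → fun s (α , x) Y.≈ fun t (α , x)
  Setoid.isEquivalence (SSet.simplices Fun n) = record
    { refl  = λ _ _ → Y.Eq.refl
    ; sym   = λ p α x → Y.Eq.sym (p α x)
    ; trans = λ p q α x → Y.Eq.trans (p α x) (q α x)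
    }
  SSet.act Fun                          = Fun-act
  SSet.act-cong Fun {x = s} {t} p q β x =
    Y.Eq.trans (cong s (lift (λ i → p (Mono.⟦_⟧ (lower β) i)) , X.Eq.refl)) (q _ x)
  SSet.act-id Fun s β x                 = cong s (lift (λ _ → ≡.refl) , X.Eq.refl)
  SSet.act-∘ Fun _ _ s β x              = cong s (lift (λ _ → ≡.refl) , X.Eq.refl)

module _ {X : SSet c e} {Y : SSet c′ e′} where

  ⌜_⌝ : X ⟶ Y → ∣ Fun X Y ∣
  ⌜ f ⌝ = f ∘ˢ sndˢ

-- Homotopy equivalence, which for Kan complexes is the equivalence of ∞-groupoids.
module _ {X : SSet c e} {Y : SSet c′ e′} where

  record IsHomotopyEquivalence (f : X ⟶ Y) : Set (c ⊔ˡ e ⊔ˡ c′ ⊔ˡ e′) where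
    field
      inverse      : Y ⟶ X
      inverse∘f≃id : [ Fun X X ] ⌜ inverse ∘ˢ f ⌝ ≃ ⌜ idˢ ⌝
      f∘inverse≃id : [ Fun Y Y ] ⌜ f ∘ˢ inverse ⌝ ≃ ⌜ idˢ ⌝

module _ {X : SSet c e} {Y : SSet c′ e′} {Z : SSet c″ e″} where

  funCompose : Fun Y Z ×ˢ Fun X Y ⟶ Fun X Z
  fun     funCompose (t , s)                                = t ∘ˢ ⟨ fstˢ , s ⟩ˢ
  cong    funCompose {x = t , s} {y = t′ , s′} (p , q) α x  =
    SSet.Eq.trans Z (p α _) (cong t′ (lift (λ _ → ≡.refl) , q α x))
  natural funCompose _ _ _ _                                = SSet.Eq.refl Z

----------------------------------------------------------------------
-- CAT∞ and ∞-categories embedded in it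

record QuasiCategory c e : Set (sucˡ (c ⊔ˡ e)) where
  field
    sset            : SSet c e
    isQuasiCategory : IsQuasiCategory sset

open QuasiCategory public using (sset)

-- CAT∞ is taken as the simplicial category of quasi-categories, with
-- the cores of the function complexes as mapping spaces.
Map : QuasiCategory c e → QuasiCategory c′ e′ → SSet (c ⊔ˡ e ⊔ˡ c′ ⊔ˡ e′) (c ⊔ˡ e′)
Map A B = Core (Fun (sset A) (sset B))

⟪_⟫ : {X : SSet c e} {Y : SSet c′ e′} → X ⟶ Y → ∣ Core (Fun X Y) ∣
⟪_⟫ {X = X} {Y = Y} f = coreVertex (Fun X Y) ⌜ f ⌝

compose : (A : QuasiCategory c e) (B : QuasiCategory c′ e′) (C : QuasiCategory c″ e″) →
  Map B C ×ˢ Map A B ⟶ Map A C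
compose A B C = mapCore funCompose ∘ˢ core-×

evaluate : (A : QuasiCategory c e) (B : QuasiCategory c′ e′) → ∣ Map A B ∣ → ∣ sset A ∣ → ∣ sset B ∣
evaluate A B (f , _) x = fun f (lift idₘ , x)

Δ⁰ : QuasiCategory c e
sset Δ⁰ = Δ 0
QuasiCategory.isQuasiCategory Δ⁰ _ _ _ _ _ = constˢ (lift idₘ) , λ _ → lift λ _ → unique
  where
  unique : {i j : Fin 1} → i ≡ j
  unique {0F} {0F} = ≡.refl

-- The map Δ⁰ → X with image x.
vertex : {X : SSet c e} → ∣ X ∣ → Δ {c′} {e′} 0 ⟶ X
fun     (vertex {X = X} x) α   = SSet.act X (lower α) x
cong    (vertex {X = X} x) p   = SSet.act-cong X (lower p) (SSet.Eq.refl X)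
natural (vertex {X = X} x) α β = SSet.act-∘ X (lower β) α x

-- The full simplicial subset on the vertices satisfying P.
record FullSimplex (X : SSet c e) (P : ∣ X ∣ → Set p) (n : ℕ) : Set (c ⊔ˡ p) where
  constructor _,_
  field
    simplex    : SSet.Simplex X n
    verticesIn : (i : 0 ⇢ n) → P (SSet.act X i simplex)

Full : (X : SSet c e) (P : ∣ X ∣ → Set p) → (∀ {x y} → SSet._≈_ X x y → P x → P y) → SSet (c ⊔ˡ p) e
SSet.simplices (Full X P resp) n = On.setoid (SSet.simplices X n) (FullSimplex.simplex {X = X} {P = P} {n = n})
SSet.act (Full X P resp) α (x , px)       = SSet.act X α x , λ i → resp (SSet.act-∘ X α i x) (px (α ∘ₘ i))
SSet.act-cong (Full X P resp) α≗β x≈y     = SSet.act-cong X α≗β x≈y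
SSet.act-id   (Full X P resp) (x , _)     = SSet.act-id X x
SSet.act-∘    (Full X P resp) β α (x , _) = SSet.act-∘ X β α x

fullVertex : (X : SSet c e) (P : ∣ X ∣ → Set p) (resp : ∀ {x y} → SSet._≈_ X x y → P x → P y) →
  (x : ∣ X ∣) → P x → ∣ Full X P resp ∣
fullVertex X P resp x px = x , λ i → resp (Eq.sym (Eq.trans (act-cong (λ { 0F → unique _ ; (Fin.suc ()) }) Eq.refl) (act-id x))) px
  where
  open SSet X
  unique : (i : Fin 1) → i ≡ 0F
  unique 0F = ≡.refl

-- A (not necessarily full) subcategory of CAT∞: a class of objects and
-- a class of morphisms closed under equivalence, identities and
-- composition, so that its mapping spaces are unions of components of
-- those of CAT∞.  ∞-categories in this form are simplicial categories
-- with Kan mapping spaces; Hom-isKan always holds classically, but is not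
-- provable constructively, so it is part of the structure.
record EmbeddedCategory c e p q : Set (sucˡ (c ⊔ˡ e ⊔ˡ p ⊔ˡ q)) where
  field
    IsObject : QuasiCategory c e → Set p

  Object : Set (sucˡ (c ⊔ˡ e) ⊔ˡ p)
  Object = Σ (QuasiCategory c e) IsObject

  underlying : Object → QuasiCategory c e
  underlying = proj₁

  U : Object → SSet c e
  U A = sset (underlying A)

  private
    Map′ : Object → Object → SSet (c ⊔ˡ e) (c ⊔ˡ e)
    Map′ A B = Map (underlying A) (underlying B)

    compose′ : ∀ A B C → Map′ B C ×ˢ Map′ A B ⟶ Map′ A C
    compose′ A B C = compose (underlying A) (underlying B) (underlying C)

  field
    IsMorphism : (A B : Object) → ∣ Map′ A B ∣ → Set q
    closed-≃   : ∀ A B {f g} → [ Map′ A B ] f ≃ g → IsMorphism A B f → IsMorphism A B g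
    closed-id  : ∀ A → IsMorphism A A ⟪ idˢ ⟫
    closed-∘   : ∀ A B C {g f} → IsMorphism B C g → IsMorphism A B f →
                 IsMorphism A C (fun (compose′ A B C) (g , f))

  closed-≈ : ∀ A B {f g} → SSet._≈_ (Map′ A B) f g → IsMorphism A B f → IsMorphism A B g
  closed-≈ A B {f} {g} f≈g = closed-≃ A B (≈⇒≃ (Map′ A B) {f} {g} f≈g)

  Hom : Object → Object → SSet (c ⊔ˡ e ⊔ˡ q) (c ⊔ˡ e)
  Hom A B = Full (Map′ A B) (IsMorphism A B) (λ {f} {g} → closed-≈ A B {f} {g})

  field
    Hom-isKan : ∀ A B → IsKan (Hom A B)

  morphism : ∀ A B (f : ∣ Map′ A B ∣) → IsMorphism A B f → ∣ Hom A B ∣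
  morphism A B = fullVertex (Map′ A B) (IsMorphism A B) (λ {f} {g} → closed-≈ A B {f} {g})

  identity : ∀ A → ∣ Hom A A ∣
  identity A = morphism A A ⟪ idˢ ⟫ (closed-id A)

  composition : ∀ A B C → Hom B C ×ˢ Hom A B ⟶ Hom A C
  fun (composition A B C) ((g , g∈) , (f , f∈)) = fun (compose′ A B C) (g , f) , λ i →
    closed-≈ A C {f = fun (compose′ A B C) (SSet.act (Map′ B C) i g , SSet.act (Map′ A B) i f)}
      (natural (compose′ A B C) i (g , f)) (closed-∘ A B C (g∈ i) (f∈ i))
  cong (composition A B C) {x = (g , _) , (f , _)} {y = (g′ , _) , (f′ , _)} =
    cong (compose′ A B C) {x = g , f} {y = g′ , f′}
  natural (composition A B C) α ((g , _) , (f , _)) = natural (compose′ A B C) α (g , f)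

  comp : ∀ A B C → ∣ Hom B C ∣ → ∣ Hom A B ∣ → ∣ Hom A C ∣
  comp A B C g f = fun (composition A B C) (g , f)

  post : ∀ A B C → ∣ Hom B C ∣ → Hom A B ⟶ Hom A C
  post A B C g = composition A B C ∘ˢ ⟨ constˢ g , idˢ ⟩ˢ

  pre : ∀ A B C → ∣ Hom A B ∣ → Hom B C ⟶ Hom A C
  pre A B C f = composition A B C ∘ˢ ⟨ idˢ , constˢ f ⟩ˢ

  apply : ∀ A B → ∣ Hom A B ∣ → ∣ U A ∣ → ∣ U B ∣
  apply A B (f , _) = evaluate (underlying A) (underlying B) f

module _ (𝒞 : EmbeddedCategory c e p q) where
  open EmbeddedCategory 𝒞

  -- Δ⁰ is terminal in 𝒞, and vertices Δ⁰ → A are morphisms of 𝒞.  Being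
  -- terminal only requires the maps A → Δ⁰ to belong to 𝒞, since
  -- Map A Δ⁰ has a single simplex in each dimension.
  record PointedByΔ⁰ : Set (sucˡ (c ⊔ˡ e) ⊔ˡ p ⊔ˡ q) where
    field
      Δ⁰-isObject : IsObject Δ⁰

    𝟙 : Object
    𝟙 = Δ⁰ , Δ⁰-isObject

    field
      toΔ⁰-isMorphism   : ∀ A → IsMorphism A 𝟙 ⟪ constˢ (lift idₘ) ⟫
      vertex-isMorphism : ∀ A (x : ∣ U A ∣) → IsMorphism 𝟙 A ⟪ vertex x ⟫

  record Products : Set (sucˡ (c ⊔ˡ e) ⊔ˡ p ⊔ˡ q) where
    infixr 5 _⊗_
    field
      _⊗_       : Object → Object → Object
      π₁        : ∀ A B → ∣ Hom (A ⊗ B) A ∣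
      π₂        : ∀ A B → ∣ Hom (A ⊗ B) B ∣
      isProduct : ∀ X A B → IsHomotopyEquivalence
                    ⟨ post X (A ⊗ B) A (π₁ A B) , post X (A ⊗ B) B (π₂ A B) ⟩ˢ

    pair : ∀ X A B → Hom X A ×ˢ Hom X B ⟶ Hom X (A ⊗ B)
    pair X A B = IsHomotopyEquivalence.inverse (isProduct X A B)

    -- f ↦ f × id_B
    timesId : ∀ X A B → Hom X A ⟶ Hom (X ⊗ B) (A ⊗ B)
    timesId X A B = pair (X ⊗ B) A B ∘ˢ ⟨ pre (X ⊗ B) X A (π₁ X B) , constˢ (π₂ X B) ⟩ˢ

  module _ (products : Products) where
    open Products products

    uncurryWith : ∀ A B C E → ∣ Hom (E ⊗ B) C ∣ → Hom A E ⟶ Hom (A ⊗ B) C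
    uncurryWith A B C E ev = post (A ⊗ B) (E ⊗ B) C ev ∘ˢ timesId A E B

    record Exponentials : Set (sucˡ (c ⊔ˡ e) ⊔ˡ p ⊔ˡ q) where
      infixr 4 _⇒_
      field
        _⇒_           : Object → Object → Object
        ev            : ∀ B C → ∣ Hom ((B ⇒ C) ⊗ B) C ∣
        isExponential : ∀ A B C → IsHomotopyEquivalence (uncurryWith A B C (B ⇒ C) (ev B C))

record CartesianClosed (𝒞 : EmbeddedCategory c e p q) : Set (sucˡ (c ⊔ˡ e) ⊔ˡ p ⊔ˡ q) where
  open EmbeddedCategory 𝒞
  field
    pointed      : PointedByΔ⁰ 𝒞
    products     : Products 𝒞
    exponentials : Exponentials 𝒞 products

  open PointedByΔ⁰ pointed public
  open Products products public
  open Exponentials exponentials public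

  curry : ∀ A B C → Hom (A ⊗ B) C ⟶ Hom A (B ⇒ C)
  curry A B C = IsHomotopyEquivalence.inverse (isExponential A B C)

  point : ∀ A → ∣ U A ∣ → ∣ Hom 𝟙 A ∣
  point A x = morphism 𝟙 A ⟪ vertex x ⟫ (vertex-isMorphism A x)

  -- The vertex classified by Δ⁰ → A.
  value : ∀ A → ∣ Hom 𝟙 A ∣ → ∣ U A ∣
  value A x = apply 𝟙 A x (lift idₘ)

  -- f(b), for a vertex f of [B ⇒ C] and a vertex b of B.
  applyVertex : ∀ B C → ∣ U (B ⇒ C) ∣ → ∣ U B ∣ → ∣ U C ∣
  applyVertex B C f b = value C (comp 𝟙 ((B ⇒ C) ⊗ B) C (ev B C)
    (fun (pair 𝟙 (B ⇒ C) B) (point (B ⇒ C) f , point B b)))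

  -- The vertex of [B ⇒ C] corresponding to a morphism B ≃ Δ⁰ × B → C.
  transpose : ∀ B C → ∣ Hom (𝟙 ⊗ B) C ∣ → ∣ U (B ⇒ C) ∣
  transpose B C f = value (B ⇒ C) (fun (curry 𝟙 B C) f)

----------------------------------------------------------------------
-- λ-terms

infixl 7 _·_
data Term : Set where
  var : ℕ → Term
  _·_ : Term → Term → Term
  ƛ   : ℕ → Term → Term

FV : Term → List ℕ
FV (var x) = x ∷ []
FV (M · N) = FV M ++ FV N
FV (ƛ x M) = filter (λ y → ¬? (y ≟ x)) (FV M)

infixl 8 _[_↦_]
_[_↦_] : ∀ {a} {A : Set a} → (ℕ → A) → ℕ → A → ℕ → A
(ρ [ x ↦ a ]) y = if does (y ≟ x) then a else ρ y

rename : ℕ → List ℕ → ℕ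
rename x ys = if does (mem? _≟_ x ys) then suc (foldr _⊔_ 0 ys) else x

-- Simultaneous substitution; a binder is renamed, to a variable above
-- all those that could be captured, only when it would capture one.
substitute : (ℕ → Term) → Term → Term
substitute σ (var x) = σ x
substitute σ (M · N) = substitute σ M · substitute σ N
substitute σ (ƛ x M) = ƛ z (substitute (σ [ x ↦ var z ]) M)
  where z = rename x (concatMap (FV ∘′ σ) (FV (ƛ x M)))

_[_/_] : Term → Term → ℕ → Term
M [ N / x ] = substitute (var [ x ↦ N ]) M

----------------------------------------------------------------------
-- Homotopic λ-models

module _ (K : SSet c e) where
  open SSet K using (_≈_)

  private
    infix 4 _≃_
    _≃_ : ∣ K ∣ → ∣ K ∣ → Set (c ⊔ˡ e)
    x ≃ y = [ K ] x ≃ y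

  module _ (_•_ : ∣ K ∣ → ∣ K ∣ → ∣ K ∣) (⟦_⟧ : Term → (ℕ → ∣ K ∣) → ∣ K ∣) where

    -- •-cong says that • is a function on the setoid of vertices.
    record IsHomotopicλModel : Set (c ⊔ˡ e) where
      field
        isKan        : IsKan K
        •-cong       : ∀ {a a′ b b′} → a ≈ a′ → b ≈ b′ → (a • b) ≈ (a′ • b′)
        ⟦var⟧        : ∀ x ρ → ⟦ var x ⟧ ρ ≈ ρ x
        ⟦·⟧          : ∀ M N ρ → ⟦ M · N ⟧ ρ ≃ (⟦ M ⟧ ρ • ⟦ N ⟧ ρ)
        ⟦ƛ⟧          : ∀ x M ρ a → (⟦ ƛ x M ⟧ ρ • a) ≃ ⟦ M ⟧ (ρ [ x ↦ a ])
        ⟦⟧-FV        : ∀ M ρ σ → (∀ x → x ∈ FV M → ρ x ≈ σ x) → ⟦ M ⟧ ρ ≈ ⟦ M ⟧ σ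
        ⟦⟧-α         : ∀ x y M ρ → y ∉ FV M → ⟦ ƛ x M ⟧ ρ ≃ ⟦ ƛ y (M [ var y / x ]) ⟧ ρ
        ⟦⟧-ξ         : ∀ x M N ρ → (∀ a → ⟦ M ⟧ (ρ [ x ↦ a ]) ≃ ⟦ N ⟧ (ρ [ x ↦ a ])) →
                       ⟦ ƛ x M ⟧ ρ ≃ ⟦ ƛ x N ⟧ ρ

    IsExtensional : Set (c ⊔ˡ e)
    IsExtensional = ∀ x M ρ → x ∉ FV M → ⟦ ƛ x (M · var x) ⟧ ρ ≃ ⟦ M ⟧ ρ

----------------------------------------------------------------------
-- Reflexive Kan complexes and the interpretation of λ-terms

module _ (𝒞 : EmbeddedCategory c e p q) (cartesianClosed : CartesianClosed 𝒞) where
  open EmbeddedCategory 𝒞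
  open CartesianClosed cartesianClosed

  IsRetraction : ∀ K → ∣ Hom K (K ⇒ K) ∣ → ∣ Hom (K ⇒ K) K ∣ → Set (c ⊔ˡ e ⊔ˡ q)
  IsRetraction K F G = [ Hom (K ⇒ K) (K ⇒ K) ] comp (K ⇒ K) K (K ⇒ K) F G ≃ identity (K ⇒ K)

  HasEnoughPoints : Object → Set (c ⊔ˡ e ⊔ˡ q)
  HasEnoughPoints K = (f g : ∣ Hom K K ∣) →
    ((x : ∣ U K ∣) → [ U K ] apply K K f x ≃ apply K K g x) → [ Hom K K ] f ≃ g

  module Interpretation (K : Object) (F : ∣ Hom K (K ⇒ K) ∣) (G : ∣ Hom (K ⇒ K) K ∣) where

    infixl 7 _•_
    _•_ : ∣ U K ∣ → ∣ U K ∣ → ∣ U K ∣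
    a • b = applyVertex K K (apply K (K ⇒ K) F a) b

    Assignment : Set c
    Assignment = ℕ → ∣ U K ∣

    infix 9 K^_
    K^_ : List ℕ → Object
    K^ []      = 𝟙
    K^ (x ∷ Γ) = K^ Γ ⊗ K

    lookup : ∀ Γ → ℕ → Assignment → ∣ Hom (K^ Γ) K ∣
    lookup []      y ρ = point K (ρ y)
    lookup (x ∷ Γ) y ρ = if does (y ≟ x) then π₂ (K^ Γ) K
                         else comp (K^ Γ ⊗ K) (K^ Γ) K (lookup Γ y ρ) (π₁ (K^ Γ) K)

    -- The morphism K^Γ → K which for Γ = xₙ ∷ … ∷ x₁ sends (d₁ , … , dₙ)
    -- to the interpretation of M under ρ [ x₁ ↦ d₁ ] … [ xₙ ↦ dₙ ].
    polynomial : ∀ Γ → Term → Assignment → ∣ Hom (K^ Γ) K ∣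
    polynomial Γ (var y) ρ = lookup Γ y ρ
    polynomial Γ (M · N) ρ = comp (K^ Γ) ((K ⇒ K) ⊗ K) K (ev K K) (fun (pair (K^ Γ) (K ⇒ K) K)
      (comp (K^ Γ) K (K ⇒ K) F (polynomial Γ M ρ) , polynomial Γ N ρ))
    polynomial Γ (ƛ x M) ρ = comp (K^ Γ) (K ⇒ K) K G (fun (curry (K^ Γ) K K) (polynomial (x ∷ Γ) M ρ))

    -- The vertex 𝛌d. ⟦ M ⟧ (ρ [ x ↦ d ]) of [K ⇒ K].
    abstraction : ℕ → Term → Assignment → ∣ U (K ⇒ K) ∣
    abstraction x M ρ = transpose K K (polynomial (x ∷ []) M ρ)

    ⟦_⟧ : Term → Assignment → ∣ U K ∣
    ⟦ var x ⟧ ρ = ρ x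
    ⟦ M · N ⟧ ρ = ⟦ M ⟧ ρ • ⟦ N ⟧ ρ
    ⟦ ƛ x M ⟧ ρ = apply (K ⇒ K) K G (abstraction x M ρ)

    -- The assertion that abstraction x M ρ is the vertex d ↦ ⟦ M ⟧ (ρ [ x ↦ d ]);
    -- when K has enough points this determines it up to ≃.
    AbstractionCorrect : Set (c ⊔ˡ e)
    AbstractionCorrect = ∀ x M ρ d →
      [ U K ] applyVertex K K (abstraction x M ρ) d ≃ ⟦ M ⟧ (ρ [ x ↦ d ])

{-# OPTIONS --safe #-}

-- After replacing the mapping spaces of 𝒞 by their sets of components, the
-- universal properties of products and exponentials become those of an
-- ordinary cartesian closed category, in which K is a reflexive object.
-- Polynomials are stable under reindexing along any t : K^Γ → K^Γ′ that matches
-- the variables, and under substitution; taking t = ⟨ id , d ⟩ identifies the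
-- vertex 𝛌d. ⟦ M ⟧ (ρ [ x ↦ d ]), and FG ≃ id then gives the β-law.  Enough
-- points, transported along K ≃ 𝟙 × K, gives the ξ-rule.  Finally
-- ⟦ ƛ x (M x) ⟧ ≃ GF ⟦ M ⟧ for x ∉ FV(M), because M x is the uncurrying of F ∘ M
-- as a polynomial in x; so extensionality says that GF and id agree on points.
module Submission where

open import Defs
open import Data.Bool.Base using (if_then_else_)
open import Data.Empty using (⊥-elim)
open import Data.Fin.Base as Fin using (Fin; pinch)
open import Data.Fin.Patterns using (0F; 1F; 2F)
open import Data.Fin.Properties using (pinch-mono-≤)
open import Data.List.Base using (List; []; _∷_; foldr; concatMap)
open import Data.List.Membership.DecPropositional using () renaming (_∈?_ to mem?)
open import Data.List.Membership.Propositional using (_∈_; _∉_; lose)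
open import Data.List.Membership.Propositional.Properties using (∈-++⁺ˡ; ∈-++⁺ʳ; ∈-filter⁺; ∈-concatMap⁺)
open import Data.List.Relation.Unary.Any using (here; there)
open import Data.Nat.Base using (ℕ; suc; _≤_; _⊔_)
open import Data.Nat.Properties using (_≟_; m≤m⊔n; m≤n⊔m; ≤-trans; 1+n≰n)
open import Data.Product.Base using (_×_; _,_; proj₁; proj₂)
open import Function.Base using (_∘′_)
open import Function.Bundles using (_⇔_; mk⇔)
open import Level using (Level; lift; lower) renaming (_⊔_ to _⊔ˡ_)
open import Relation.Binary.Bundles using (Setoid)
open import Relation.Binary.PropositionalEquality.Core as ≡ using (_≡_; _≢_)
import Relation.Binary.Reasoning.Setoid as SetoidReasoning
open import Relation.Binary.Structures using (IsEquivalence)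
open import Relation.Nullary.Decidable using (Dec; yes; no; ¬?; dec-true; dec-false)

private
  variable
    c e c′ e′ c″ e″ : Level

-- Homotopies between vertices

Fin1-unique : (i j : Fin 1) → i ≡ j
Fin1-unique 0F 0F = ≡.refl

σ : ∀ {n} → Fin (suc n) → suc n ⇢ n
σ i = monotone (pinch i) (pinch-mono-≤ i)

module _ {X : SSet c e} where
  open SSet X

  ≃-refl : ∀ {x} → [ X ] x ≃ x
  ≃-refl = ≈⇒≃ X Eq.refl

  module _ (isKan : IsKan X) where

    -- The two given edges form a horn Λ[ 2 , 0 ]; the third edge of its filler
    -- joins y and z.
    ≃-euclidean : ∀ {x y z} → [ X ] x ≃ y → [ X ] x ≃ z → [ X ] y ≃ z
    ≃-euclidean {x} {y} {z} (joinedBy f f₁ f₀) (joinedBy g g₁ g₀) =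
      joinedBy (fun filler (lift (δ 0F))) filler-source filler-target
      where
      -- A simplex of the horn missing both 1 and 2 is constant at 0.
      onInitial : ∀ {m} {α β : m ⇢ 2} → α ≗ β →
        (∀ k → Mono.⟦_⟧ α k ≢ 1F) → (∀ k → Mono.⟦_⟧ β k ≢ 2F) →
        act (σ 0F ∘ₘ α) g ≈ act (σ 1F ∘ₘ β) f
      onInitial {m} {α} {β} α≗β α≢1 β≢2 = begin
        act (σ 0F ∘ₘ α) g          ≈⟨ act-cong (λ k → ≡.cong (pinch 0F) (α≡0 k)) Eq.refl ⟩
        act (δ 1F ∘ₘ constₘ 0F) g  ≈⟨ act-∘ (δ 1F) (constₘ 0F) g ⟩
        degenerate (source g)      ≈⟨ act-congʳ (constₘ 0F) (Eq.trans g₁ (Eq.sym f₁)) ⟩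
        degenerate (source f)      ≈⟨ act-∘ (δ 1F) (constₘ 0F) f ⟨
        act (δ 1F ∘ₘ constₘ 0F) f
          ≈⟨ act-cong (λ k → ≡.cong (pinch 1F) (≡.trans (≡.sym (α≡0 k)) (α≗β k))) Eq.refl ⟩
        act (σ 1F ∘ₘ β) f          ∎
        where
        open SetoidReasoning (simplices m)
        α≡0 : ∀ k → Mono.⟦_⟧ α k ≡ 0F
        α≡0 k with Mono.⟦_⟧ α k in eq
        ... | 0F = ≡.refl
        ... | 1F = ⊥-elim (α≢1 k eq)
        ... | 2F = ⊥-elim (β≢2 k (≡.trans (≡.sym (α≗β k)) eq))

      horn : Λ[ 2 , 0F ] ⟶ X
      fun horn (_ , 0F , 0≢0 , _)      = ⊥-elim (0≢0 ≡.refl)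
      -- `σ 0F` restricts to an isomorphism from {0 , 2} to [1] and `σ 1F` to one from {0 , 1}, so
      -- composing with them places `g` on the edge 02 and `f` on the edge 01.
      fun horn (lift α , 1F , _ , _)   = act (σ 0F ∘ₘ α) g
      fun horn (lift α , 2F , _ , _)   = act (σ 1F ∘ₘ α) f
      cong horn {x = _ , 0F , 0≢0 , _} = ⊥-elim (0≢0 ≡.refl)
      cong horn {x = _ , 1F , _ , _} {_ , 0F , 0≢0 , _} = ⊥-elim (0≢0 ≡.refl)
      cong horn {x = _ , 2F , _ , _} {_ , 0F , 0≢0 , _} = ⊥-elim (0≢0 ≡.refl)
      cong horn {x = _ , 1F , _ , _} {_ , 1F , _ , _} p =
        act-cong (λ k → ≡.cong (pinch 0F) (lower p k)) Eq.refl
      cong horn {x = _ , 1F , _ , α≢1} {_ , 2F , _ , β≢2} p = onInitial (lower p) α≢1 β≢2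
      cong horn {x = _ , 2F , _ , β≢2} {_ , 1F , _ , α≢1} p =
        Eq.sym (onInitial (λ k → ≡.sym (lower p k)) α≢1 β≢2)
      cong horn {x = _ , 2F , _ , _} {_ , 2F , _ , _} p =
        act-cong (λ k → ≡.cong (pinch 1F) (lower p k)) Eq.refl
      natural horn _ (_ , 0F , 0≢0 , _)    = ⊥-elim (0≢0 ≡.refl)
      natural horn γ (lift α , 1F , _ , _) = act-∘ (σ 0F ∘ₘ α) γ g
      natural horn γ (lift α , 2F , _ , _) = act-∘ (σ 1F ∘ₘ α) γ f

      filler : Δ[ 2 ] ⟶ X
      filler = proj₁ (isKan 1 0F horn)

      fills : ∀ {m} (s : SSet.Simplex Λ[ 2 , 0F ] m) → fun filler (proj₁ s) ≈ fun horn s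
      fills = proj₂ (isKan 1 0F horn)

      filler-source : source (fun filler (lift (δ 0F))) ≈ y
      filler-source = begin
        source (fun filler (lift (δ 0F)))     ≈⟨ natural filler (δ 1F) (lift (δ 0F)) ⟨
        -- `δ 0F ∘ₘ δ 1F` is the vertex 1, which misses 2 and so lies on the edge carrying `f`.
        -- Likewise `δ 0F ∘ₘ δ 0F` below is the vertex 2, on the edge carrying `g`.
        fun filler (lift (δ 0F ∘ₘ δ 1F))      ≈⟨ fills (lift (δ 0F ∘ₘ δ 1F) , 2F , (λ ()) , λ { 0F () }) ⟩
        act (σ 1F ∘ₘ (δ 0F ∘ₘ δ 1F)) f        ≈⟨ act-cong (λ { 0F → ≡.refl ; (Fin.suc ()) }) Eq.refl ⟩
        target f                              ≈⟨ f₀ ⟩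
        y                                     ∎
        where open SetoidReasoning (simplices 0)

      filler-target : target (fun filler (lift (δ 0F))) ≈ z
      filler-target = begin
        target (fun filler (lift (δ 0F)))     ≈⟨ natural filler (δ 0F) (lift (δ 0F)) ⟨
        fun filler (lift (δ 0F ∘ₘ δ 0F))      ≈⟨ fills (lift (δ 0F ∘ₘ δ 0F) , 1F , (λ ()) , λ { 0F () }) ⟩
        act (σ 0F ∘ₘ (δ 0F ∘ₘ δ 0F)) g        ≈⟨ act-cong (λ { 0F → ≡.refl ; (Fin.suc ()) }) Eq.refl ⟩
        target g                              ≈⟨ g₀ ⟩
        z                                     ∎
        where open SetoidReasoning (simplices 0)

    ≃-sym : ∀ {x y} → [ X ] x ≃ y → [ X ] y ≃ x
    ≃-sym x≃y = ≃-euclidean x≃y ≃-refl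

    ≃-trans : ∀ {x y z} → [ X ] x ≃ y → [ X ] y ≃ z → [ X ] x ≃ z
    ≃-trans x≃y = ≃-euclidean (≃-sym x≃y)

    ≃-setoid : Setoid c (c ⊔ˡ e)
    ≃-setoid = record
      { Carrier       = ∣ X ∣
      ; _≈_           = [ X ]_≃_
      ; isEquivalence = record { refl = ≃-refl ; sym = ≃-sym ; trans = ≃-trans }
      }

module _ {X : SSet c e} {Y : SSet c′ e′} where
  private
    module X = SSet X
    module Y = SSet Y

  map-≃ : (h : X ⟶ Y) → ∀ {x x′} → [ X ] x ≃ x′ → [ Y ] fun h x ≃ fun h x′
  map-≃ h (joinedBy f f₁ f₀) = joinedBy (fun h f)
    (Y.Eq.trans (Y.Eq.sym (natural h (δ 1F) f)) (cong h f₁))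
    (Y.Eq.trans (Y.Eq.sym (natural h (δ 0F) f)) (cong h f₀))

  pair-≃ : ∀ {x x′ y y′} → [ X ] x ≃ x′ → [ Y ] y ≃ y′ → [ X ×ˢ Y ] (x , y) ≃ (x′ , y′)
  pair-≃ (joinedBy f f₁ f₀) (joinedBy g g₁ g₀) = joinedBy (f , g) (f₁ , g₁) (f₀ , g₀)

  -- A homotopy is a map out of `Δ[ 1 ] ×ˢ X`; its restriction to the nondegenerate edge of `Δ[ 1 ]`
  -- paired with the degenerate edge at `x` is the required edge.
  homotopy-at : ∀ {s t : ∣ Fun X Y ∣} → [ Fun X Y ] s ≃ t → ∀ x →
    [ Y ] fun s (lift idₘ , x) ≃ fun t (lift idₘ , x)
  homotopy-at {s} {t} (joinedBy h h₁ h₀) x =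
    joinedBy (fun h (lift idₘ , X.degenerate x)) (end 1F s h₁) (end 0F t h₀)
    where
    end : ∀ (i : Fin 2) u → SSet._≈_ (Fun X Y) (SSet.face (Fun X Y) i h) u →
      Y.face i (fun h (lift idₘ , X.degenerate x)) Y.≈ fun u (lift idₘ , x)
    end i u p = begin
      Y.face i (fun h (lift idₘ , X.degenerate x))          ≈⟨ natural h (δ i) _ ⟨
      fun h (lift (idₘ ∘ₘ δ i) , X.face i (X.degenerate x))
        ≈⟨ cong h (lift (λ _ → ≡.refl) , X.Eq.trans (act-degenerate X (δ i) x) (degenerate₀ X x)) ⟩
      fun h (lift (δ i ∘ₘ idₘ) , x)                         ≈⟨ p (lift idₘ) x ⟩
      fun u (lift idₘ , x)                                  ∎
      where open SetoidReasoning (Y.simplices 0)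


module _ {X : SSet c e} where

  ≃-respˡ-≈ : ∀ {x x′ y} → SSet._≈_ X x x′ → [ X ] x ≃ y → [ X ] x′ ≃ y
  ≃-respˡ-≈ x≈x′ (joinedBy f f₁ f₀) = joinedBy f (SSet.Eq.trans X f₁ x≈x′) f₀

module _ {X : SSet c e} {Y : SSet c′ e′} {f : X ⟶ Y} (f-equiv : IsHomotopyEquivalence f) where
  open IsHomotopyEquivalence f-equiv

  inverse∘f-at : ∀ x → [ X ] fun inverse (fun f x) ≃ x
  inverse∘f-at = homotopy-at inverse∘f≃id

  f∘inverse-at : ∀ y → [ Y ] fun f (fun inverse y) ≃ y
  f∘inverse-at = homotopy-at f∘inverse≃id

module _ {X : SSet c e} {Y : SSet c′ e′} {Z : SSet c″ e″} {f : Z ⟶ X} {g : Z ⟶ Y}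
  (fg-equiv : IsHomotopyEquivalence ⟨ f , g ⟩ˢ) where
  open IsHomotopyEquivalence fg-equiv

  fst-inverse : ∀ x y → [ X ] fun f (fun inverse (x , y)) ≃ x
  fst-inverse x y = map-≃ (fstˢ {X = X} {Y = Y}) (f∘inverse-at fg-equiv (x , y))

  snd-inverse : ∀ x y → [ Y ] fun g (fun inverse (x , y)) ≃ y
  snd-inverse x y = map-≃ (sndˢ {X = X} {Y = Y}) (f∘inverse-at fg-equiv (x , y))

  -- The uniqueness half of the universal property: `inverse (x , y)` equals `inverse (f z , g z)`
  -- strictly, and the latter is homotopic to `z`.
  inverse-pair-unique : ∀ {x y z} → SSet._≈_ X (fun f z) x → SSet._≈_ Y (fun g z) y →
    [ Z ] fun inverse (x , y) ≃ z
  inverse-pair-unique {z = z} fz≈x gz≈y = ≃-respˡ-≈ (cong inverse (fz≈x , gz≈y)) (inverse∘f-at fg-equiv z)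

-- Variables and substitution

update-≡ : ∀ {a} {A : Set a} (ρ : ℕ → A) x v → (ρ [ x ↦ v ]) x ≡ v
update-≡ ρ x v = ≡.cong (if_then v else ρ x) (dec-true (x ≟ x) ≡.refl)

update-≢ : ∀ {a} {A : Set a} (ρ : ℕ → A) {x y} v → y ≢ x → (ρ [ x ↦ v ]) y ≡ ρ y
update-≢ ρ {x} {y} v y≢x = ≡.cong (if_then v else ρ y) (dec-false (y ≟ x) y≢x)

∈⇒≤foldr-⊔ : ∀ {x xs} → x ∈ xs → x ≤ foldr _⊔_ 0 xs
∈⇒≤foldr-⊔ (here ≡.refl) = m≤m⊔n _ _
∈⇒≤foldr-⊔ {xs = y ∷ _} (there x∈xs) = ≤-trans (∈⇒≤foldr-⊔ x∈xs) (m≤n⊔m y _)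

-- When a new variable is chosen, it exceeds the maximum of `ys`.
rename-fresh : ∀ x ys → rename x ys ∉ ys
rename-fresh x ys with mem? _≟_ x ys
... | yes _   = λ max∈ys → 1+n≰n (∈⇒≤foldr-⊔ max∈ys)
... | no x∉ys = x∉ys

FV-ƛ : ∀ {x y} M → y ∈ FV M → y ≢ x → y ∈ FV (ƛ x M)
FV-ƛ {x} M y∈M y≢x = ∈-filter⁺ (λ y → ¬? (y ≟ x)) y∈M y≢x

-- The homotopy category of 𝒞

module HomotopyCategory {c e p q} (𝒞 : EmbeddedCategory c e p q) (cartesianClosed : CartesianClosed 𝒞) where
  open EmbeddedCategory 𝒞
  open CartesianClosed cartesianClosed

  private
    variable
      A B C D : Object

  -- `post` is built from `constˢ g`, whose value in dimension 0 is `degenerate g`; this is `g` only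
  -- up to `_≈_`.
  post-≈ : ∀ A B C (g : ∣ Hom B C ∣) (f : ∣ Hom A B ∣) →
    SSet._≈_ (Hom A C) (fun (post A B C g) f) (comp A B C g f)
  post-≈ A B C g f = cong (composition A B C) {x = SSet.degenerate (Hom B C) g , f} {y = g , f}
    (degenerate₀ (Hom B C) g , SSet.Eq.refl (Hom A B) {x = f})

  pre-≈ : ∀ A B C (f : ∣ Hom A B ∣) (g : ∣ Hom B C ∣) →
    SSet._≈_ (Hom A C) (fun (pre A B C f) g) (comp A B C g f)
  pre-≈ A B C f g = cong (composition A B C) {x = g , SSet.degenerate (Hom A B) f} {y = g , f}
    (SSet.Eq.refl (Hom B C) {x = g} , degenerate₀ (Hom A B) f)

  opaque
    -- A sealed name for the adjunction map, unfolded only to compare it with `eval ∘ times f` and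
    -- its inverse with `curry`.
    uncurryˢ : ∀ A B C → Hom A (B ⇒ C) ⟶ Hom (A ⊗ B) C
    uncurryˢ A B C = uncurryWith 𝒞 products A B C (B ⇒ C) (ev B C)

    uncurryˢ-equivalence : ∀ A B C → IsHomotopyEquivalence (uncurryˢ A B C)
    uncurryˢ-equivalence A B C = isExponential A B C

  curryˢ : ∀ A B C → Hom (A ⊗ B) C ⟶ Hom A (B ⇒ C)
  curryˢ A B C = IsHomotopyEquivalence.inverse (uncurryˢ-equivalence A B C)

  -- Opaque, so that comparing morphisms never unfolds the equivalence proofs
  -- carried by the simplices of Full and Core.
  opaque
    Mor : Object → Object → Set (c ⊔ˡ e ⊔ˡ q)
    Mor A B = ∣ Hom A B ∣

    infix 4 _≃_
    _≃_ : Mor A B → Mor A B → Set (c ⊔ˡ e ⊔ˡ q)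
    _≃_ {A} {B} f g = [ Hom A B ] f ≃ g

    toMor : ∣ Hom A B ∣ → Mor A B
    toMor f = f

    infix 4 _≈_
    -- Strict equality is kept beside `_≃_` because `•-cong` and `⟦⟧-FV` are stated with it.
    _≈_ : Mor A B → Mor A B → Set (c ⊔ˡ e)
    _≈_ {A} {B} f g = SSet._≈_ (Hom A B) f g

    ≈-isEquivalence : IsEquivalence (_≈_ {A} {B})
    ≈-isEquivalence {A} {B} = Setoid.isEquivalence (SSet.simplices (Hom A B) 0)

    ≈⇒≃ᵐ : {f g : Mor A B} → f ≈ g → f ≃ g
    ≈⇒≃ᵐ {A} {B} = ≈⇒≃ (Hom A B)

    ≃-isEquivalence : IsEquivalence (_≃_ {A} {B})
    ≃-isEquivalence {A} {B} = Setoid.isEquivalence (≃-setoid (Hom-isKan A B))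

    infixr 9 _∘_
    _∘_ : Mor B C → Mor A B → Mor A C
    _∘_ {B} {C} {A} g f = comp A B C g f

    id : Mor A A
    id {A} = identity A

    ⟨_,_⟩ : Mor A B → Mor A C → Mor A (B ⊗ C)
    ⟨_,_⟩ {A} {B} {C} f g = fun (pair A B C) (f , g)

    Λ : Mor (A ⊗ B) C → Mor A (B ⇒ C)
    Λ {A} {B} {C} h = fun (curryˢ A B C) h

  -- Products and exponentials up to homotopy

  fst : Mor (A ⊗ B) A
  fst {A} {B} = toMor (π₁ A B)

  snd : Mor (A ⊗ B) B
  snd {A} {B} = toMor (π₂ A B)

  eval : Mor ((A ⇒ B) ⊗ A) B
  eval {A} {B} = toMor (ev A B)

  homSetoid : Object → Object → Setoid _ _
  homSetoid A B = record { isEquivalence = ≃-isEquivalence {A} {B} }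

  module ≃ {A B} = Setoid (homSetoid A B)
  module ≃-Reasoning {A B} = SetoidReasoning (homSetoid A B)

  infixl 10 _×id
  _×id : Mor A B → Mor (A ⊗ C) (B ⊗ C)
  f ×id = ⟨ f ∘ fst , snd ⟩

  opaque
    unfolding Mor

    ∘-cong : {g g′ : Mor B C} {f f′ : Mor A B} → g ≃ g′ → f ≃ f′ → g ∘ f ≃ g′ ∘ f′
    ∘-cong {B} {C} {A} {g} {g′} {f} {f′} g≃g′ f≃f′ = map-≃ (composition A B C) {g , f} {g′ , f′} (pair-≃ g≃g′ f≃f′)

    ∘-cong-≈ : {g g′ : Mor B C} {f f′ : Mor A B} → g ≈ g′ → f ≈ f′ → g ∘ f ≈ g′ ∘ f′
    ∘-cong-≈ {B} {C} {A} {g} {g′} {f} {f′} g≈g′ f≈f′ =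
      cong (composition A B C) {x = g , f} {y = g′ , f′} (g≈g′ , f≈f′)

    -- Composition is computed simplex by simplex, so both sides agree strictly and a degenerate
    -- edge joins them. The unit laws hold for the same reason.
    ∘-assoc : (h : Mor C D) (g : Mor B C) (f : Mor A B) → (h ∘ g) ∘ f ≃ h ∘ (g ∘ f)
    ∘-assoc {C} {D} {B} {A} h g f = ≈⇒≃ (Hom A D) (λ _ _ → SSet.Eq.refl (U D))

    ∘-identityˡ : (f : Mor A B) → id ∘ f ≃ f
    ∘-identityˡ {A} {B} f = ≈⇒≃ (Hom A B) (λ _ _ → SSet.Eq.refl (U B))

    ∘-identityʳ : (f : Mor A B) → f ∘ id ≃ f
    ∘-identityʳ {A} {B} f = ≈⇒≃ (Hom A B) (λ _ _ → SSet.Eq.refl (U B))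

    ⟨⟩-cong-≈ : {f f′ : Mor A B} {g g′ : Mor A C} → f ≈ f′ → g ≈ g′ → ⟨ f , g ⟩ ≈ ⟨ f′ , g′ ⟩
    ⟨⟩-cong-≈ {A} {B} {C} {f} {f′} {g} {g′} f≈f′ g≈g′ =
      cong (pair A B C) {x = f , g} {y = f′ , g′} (f≈f′ , g≈g′)

    Λ-cong-≈ : {h h′ : Mor (A ⊗ B) C} → h ≈ h′ → Λ h ≈ Λ h′
    Λ-cong-≈ {A} {B} {C} {h} {h′} h≈h′ = cong (curryˢ A B C) {x = h} {y = h′} h≈h′

    ⟨⟩-cong : {f f′ : Mor A B} {g g′ : Mor A C} → f ≃ f′ → g ≃ g′ → ⟨ f , g ⟩ ≃ ⟨ f′ , g′ ⟩
    ⟨⟩-cong {A} {B} {C} f≃f′ g≃g′ = map-≃ (pair A B C) (pair-≃ f≃f′ g≃g′)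

    Λ-cong : {h h′ : Mor (A ⊗ B) C} → h ≃ h′ → Λ h ≃ Λ h′
    Λ-cong {A} {B} {C} h≃h′ = map-≃ (curryˢ A B C) h≃h′

    fst-⟨⟩ : (f : Mor A B) (g : Mor A C) → fst ∘ ⟨ f , g ⟩ ≃ f
    fst-⟨⟩ {A} {B} {C} f g = ≃-respˡ-≈ (post-≈ A (B ⊗ C) B (π₁ B C) ⟨ f , g ⟩) (fst-inverse (isProduct A B C) f g)

    snd-⟨⟩ : (f : Mor A B) (g : Mor A C) → snd ∘ ⟨ f , g ⟩ ≃ g
    snd-⟨⟩ {A} {B} {C} f g = ≃-respˡ-≈ (post-≈ A (B ⊗ C) C (π₂ B C) ⟨ f , g ⟩) (snd-inverse (isProduct A B C) f g)

    ⟨⟩-η : (h : Mor A (B ⊗ C)) → ⟨ fst ∘ h , snd ∘ h ⟩ ≃ h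
    ⟨⟩-η {A} {B} {C} h = inverse-pair-unique (isProduct A B C)
      (post-≈ A (B ⊗ C) B (π₁ B C) h) (post-≈ A (B ⊗ C) C (π₂ B C) h)

    uncurry : Mor A (B ⇒ C) → Mor (A ⊗ B) C
    uncurry {A} {B} {C} f = fun (uncurryˢ A B C) f

    times : Mor A C → Mor (A ⊗ B) (C ⊗ B)
    times {A} {C} {B} f = fun (timesId A C B) f

    uncurry-Λ : (h : Mor (A ⊗ B) C) → uncurry (Λ h) ≃ h
    uncurry-Λ {A} {B} {C} h = f∘inverse-at (uncurryˢ-equivalence A B C) h

    Λ-uncurry : (f : Mor A (B ⇒ C)) → Λ (uncurry f) ≃ f
    Λ-uncurry {A} {B} {C} f = inverse∘f-at (uncurryˢ-equivalence A B C) f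

    times≈×id : (f : Mor A C) → times {B = B} f ≈ f ×id
    times≈×id {A} {C} {B} f = cong (pair (A ⊗ B) C B)
      (pre-≈ (A ⊗ B) A C (π₁ A B) f , degenerate₀ (Hom (A ⊗ B) B) (π₂ A B))

  opaque
    unfolding Mor uncurry uncurryˢ

    uncurry≈eval∘times : (f : Mor A (B ⇒ C)) → uncurry f ≈ eval ∘ times f
    uncurry≈eval∘times {A} {B} {C} f = post-≈ (A ⊗ B) ((B ⇒ C) ⊗ B) C (ev B C) (fun (timesId A (B ⇒ C) B) f)

  -- Vertices as morphisms out of `𝟙`

  Vertex : Object → Set c
  Vertex A = ∣ U A ∣

  opaque
    unfolding Mor

    pt : ∀ A → Vertex A → Mor 𝟙 A
    pt A x = point A x

    val : Mor 𝟙 A → Vertex A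
    val {A} f = value A f

    app : Mor A B → Vertex A → Vertex B
    app {A} {B} f x = apply A B f x

    -- There is a single monotone map from [m] to [0], so the two maps agree strictly.
    𝟙-unique : (f g : Mor A 𝟙) → f ≃ g
    𝟙-unique {A} f g = ≈⇒≃ (Hom A 𝟙) (λ _ _ → lift (λ _ → Fin1-unique _ _))

    pt-cong-≈ : ∀ A {x y} → SSet._≈_ (U A) x y → pt A x ≈ pt A y
    pt-cong-≈ A x≈y (lift α) (lift β) = SSet.act-congʳ (U A) β x≈y

    val-cong-≈ : {f g : Mor 𝟙 A} → f ≈ g → SSet._≈_ (U A) (val f) (val g)
    val-cong-≈ f≈g = f≈g (lift idₘ) (lift idₘ)

    app-cong-≈ : (f : Mor A B) {x y : Vertex A} → SSet._≈_ (U A) x y → SSet._≈_ (U B) (app f x) (app f y)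
    app-cong-≈ ((f , _) , _) x≈y = cong f (lift (λ _ → ≡.refl) , x≈y)

    -- An edge of `Hom 𝟙 A` has an underlying edge of the function complex, that is, a homotopy, and
    -- this can be evaluated at the vertex of `Δ 0`.
    val-cong : {f g : Mor 𝟙 A} → f ≃ g → [ U A ] val f ≃ val g
    val-cong {f = (f , _) , _} {(g , _) , _} (joinedBy ((h , _) , _) h₁ h₀) =
      homotopy-at {s = f} {g} (joinedBy h h₁ h₀) (lift idₘ)

    app-cong : {f g : Mor A B} → f ≃ g → ∀ x → [ U B ] app f x ≃ app g x
    app-cong {f = (f , _) , _} {(g , _) , _} (joinedBy ((h , _) , _) h₁ h₀) =
      homotopy-at {s = f} {g} (joinedBy h h₁ h₀)

    val-pt : ∀ A x → SSet._≈_ (U A) (val (pt A x)) x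
    val-pt A x = SSet.act-id (U A) x

    app-id : ∀ A x → SSet._≈_ (U A) (app (id {A}) x) x
    app-id A x = SSet.Eq.refl (U A)

    -- Every simplex of `Δ[ 0 ] ×ˢ Δ 0` is pulled back from its only vertex, so by naturality the
    -- value there determines the whole map.
    pt-val : (f : Mor 𝟙 A) → pt A (val f) ≃ f
    pt-val {A} f@((f′ , _) , _) = ≈⇒≃ (Hom 𝟙 A) λ (lift α) (lift β) →
      SSet.Eq.trans (U A) (SSet.Eq.sym (U A) (natural f′ β (lift idₘ , lift idₘ)))
        (cong f′ (lift (λ _ → Fin1-unique _ _) , lift (λ _ → ≡.refl)))

    pt-app : (f : Mor A B) (x : Vertex A) → pt B (app f x) ≃ f ∘ pt A x
    pt-app {A} {B} f@((f′ , _) , _) x = ≈⇒≃ (Hom 𝟙 B) λ (lift α) (lift β) →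
      SSet.Eq.trans (U B) (SSet.Eq.sym (U B) (natural f′ β (lift idₘ , x)))
        (cong f′ (lift (λ _ → Fin1-unique _ _) , SSet.Eq.refl (U A)))

    app≈val : (f : Mor A B) (x : Vertex A) → SSet._≈_ (U B) (app f x) (val (f ∘ pt A x))
    app≈val {A} {B} ((f′ , _) , _) x = cong f′ (lift (λ _ → ≡.refl) , SSet.Eq.sym (U A) (SSet.act-id (U A) x))

  opaque
    unfolding pt Mor uncurryˢ

    -- This and the following equations connect the sealed operations on `Mor` with the original
    -- data; they hold by computation once the seals are opened, and are used as rewriting steps
    -- elsewhere.
    toMor-≃ : {f g : ∣ Hom A B ∣} → [ Hom A B ] f ≃ g → toMor f ≃ toMor g
    toMor-≃ f≃g = f≃g

    fromMor-≃ : {f g : ∣ Hom A B ∣} → toMor f ≃ toMor g → [ Hom A B ] f ≃ g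
    fromMor-≃ f≃g = f≃g

    toMor-identity : ∀ A → toMor (identity A) ≡ id
    toMor-identity A = ≡.refl

    toMor-comp : ∀ A B C g f → toMor (comp A B C g f) ≡ toMor g ∘ toMor f
    toMor-comp A B C g f = ≡.refl

    toMor-pair : ∀ A B C f g → toMor (fun (pair A B C) (f , g)) ≡ ⟨ toMor f , toMor g ⟩
    toMor-pair A B C f g = ≡.refl

    toMor-curry : ∀ A B C h → toMor (fun (curry A B C) h) ≡ Λ (toMor h)
    toMor-curry A B C h = ≡.refl

    toMor-point : ∀ A x → toMor (point A x) ≡ pt A x
    toMor-point A x = ≡.refl

    apply≡app : ∀ A B f x → apply A B f x ≡ app (toMor f) x
    apply≡app A B f x = ≡.refl

    value≡val : ∀ A f → value A f ≡ val (toMor f)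
    value≡val A f = ≡.refl

  module ≈ {A B} = IsEquivalence (≈-isEquivalence {A} {B})

  -- Equational calculus of the cartesian closed homotopy category

  ∘-congˡ : {g : Mor B C} {f f′ : Mor A B} → f ≃ f′ → g ∘ f ≃ g ∘ f′
  ∘-congˡ = ∘-cong ≃.refl

  ∘-congʳ : {g g′ : Mor B C} {f : Mor A B} → g ≃ g′ → g ∘ f ≃ g′ ∘ f
  ∘-congʳ g≃g′ = ∘-cong g≃g′ ≃.refl

  -- By surjective pairing it suffices to compare the two projections.
  ⟨⟩-∘ : (f : Mor B C) (g : Mor B D) (h : Mor A B) → ⟨ f , g ⟩ ∘ h ≃ ⟨ f ∘ h , g ∘ h ⟩
  ⟨⟩-∘ f g h = begin
    ⟨ f , g ⟩ ∘ h                                        ≈⟨ ⟨⟩-η (⟨ f , g ⟩ ∘ h) ⟨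
    ⟨ fst ∘ (⟨ f , g ⟩ ∘ h) , snd ∘ (⟨ f , g ⟩ ∘ h) ⟩    ≈⟨ ⟨⟩-cong (∘-assoc fst _ h) (∘-assoc snd _ h) ⟨
    ⟨ (fst ∘ ⟨ f , g ⟩) ∘ h , (snd ∘ ⟨ f , g ⟩) ∘ h ⟩
      ≈⟨ ⟨⟩-cong (∘-congʳ (fst-⟨⟩ f g)) (∘-congʳ (snd-⟨⟩ f g)) ⟩
    ⟨ f ∘ h , g ∘ h ⟩                                    ∎
    where open ≃-Reasoning

  ⟨fst,snd⟩ : ⟨ fst , snd ⟩ ≃ id {A ⊗ B}
  ⟨fst,snd⟩ = ≃.trans (⟨⟩-cong (≃.sym (∘-identityʳ fst)) (≃.sym (∘-identityʳ snd))) (⟨⟩-η id)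

  ×id-⟨⟩ : (f : Mor B C) (g : Mor A B) (h : Mor A D) → f ×id ∘ ⟨ g , h ⟩ ≃ ⟨ f ∘ g , h ⟩
  ×id-⟨⟩ f g h = begin
    f ×id ∘ ⟨ g , h ⟩                                  ≈⟨ ⟨⟩-∘ (f ∘ fst) snd ⟨ g , h ⟩ ⟩
    ⟨ (f ∘ fst) ∘ ⟨ g , h ⟩ , snd ∘ ⟨ g , h ⟩ ⟩        ≈⟨ ⟨⟩-cong (∘-assoc f fst _) (snd-⟨⟩ g h) ⟩
    ⟨ f ∘ (fst ∘ ⟨ g , h ⟩) , h ⟩                      ≈⟨ ⟨⟩-cong (∘-congˡ (fst-⟨⟩ g h)) ≃.refl ⟩
    ⟨ f ∘ g , h ⟩                                      ∎
    where open ≃-Reasoning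

  ×id-∘ : (g : Mor B C) (f : Mor A B) → g ×id ∘ _×id {C = D} f ≃ (g ∘ f) ×id
  ×id-∘ g f = ≃.trans (×id-⟨⟩ g (f ∘ fst) snd) (⟨⟩-cong (≃.sym (∘-assoc g f fst)) ≃.refl)

  -- This gives the adjunction its usual formula, so that its two inverse laws become `Λ-β` and
  -- `Λ-η`.
  uncurry-⟨⟩ : (f : Mor A (B ⇒ C)) → uncurry f ≃ eval ∘ f ×id
  uncurry-⟨⟩ f = ≃.trans (≈⇒≃ᵐ (uncurry≈eval∘times f)) (∘-congˡ (≈⇒≃ᵐ (times≈×id f)))

  Λ-β : (h : Mor (A ⊗ B) C) → eval ∘ Λ h ×id ≃ h
  Λ-β h = ≃.trans (≃.sym (uncurry-⟨⟩ (Λ h))) (uncurry-Λ h)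

  Λ-η : (f : Mor A (B ⇒ C)) → Λ (eval ∘ f ×id) ≃ f
  Λ-η f = ≃.trans (Λ-cong (≃.sym (uncurry-⟨⟩ f))) (Λ-uncurry f)

  -- `isExponential` treats each domain separately and does not state that currying is natural.
  -- Naturality follows by expanding with `Λ-η` and cancelling with `Λ-β`.
  Λ-∘ : (h : Mor (B ⊗ C) D) (t : Mor A B) → Λ h ∘ t ≃ Λ (h ∘ t ×id)
  Λ-∘ h t = begin
    Λ h ∘ t                             ≈⟨ Λ-η (Λ h ∘ t) ⟨
    Λ (eval ∘ (Λ h ∘ t) ×id)            ≈⟨ Λ-cong (∘-congˡ (×id-∘ (Λ h) t)) ⟨
    Λ (eval ∘ (Λ h ×id ∘ t ×id))        ≈⟨ Λ-cong (∘-assoc eval _ _) ⟨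
    Λ ((eval ∘ Λ h ×id) ∘ t ×id)        ≈⟨ Λ-cong (∘-congʳ (Λ-β h)) ⟩
    Λ (h ∘ t ×id)                       ∎
    where open ≃-Reasoning

  -- The pair factors as `Λ h ×id` after `⟨ id , a ⟩`, which brings it into the form of `Λ-β`.
  eval-Λ : (h : Mor (A ⊗ B) C) (a : Mor A B) → eval ∘ ⟨ Λ h , a ⟩ ≃ h ∘ ⟨ id , a ⟩
  eval-Λ h a = begin
    eval ∘ ⟨ Λ h , a ⟩                  ≈⟨ ∘-congˡ (⟨⟩-cong (∘-identityʳ (Λ h)) ≃.refl) ⟨
    eval ∘ ⟨ Λ h ∘ id , a ⟩             ≈⟨ ∘-congˡ (×id-⟨⟩ (Λ h) id a) ⟨
    eval ∘ (Λ h ×id ∘ ⟨ id , a ⟩)       ≈⟨ ∘-assoc eval _ _ ⟨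
    (eval ∘ Λ h ×id) ∘ ⟨ id , a ⟩       ≈⟨ ∘-congʳ (Λ-β h) ⟩
    h ∘ ⟨ id , a ⟩                      ∎
    where open ≃-Reasoning

  -- Application and transposition of vertices

  infixl 9 _⊛_
  _⊛_ : Vertex (A ⇒ B) → Vertex A → Vertex B
  _⊛_ {A} {B} f a = val (eval ∘ ⟨ pt (A ⇒ B) f , pt A a ⟩)

  bang : Mor A 𝟙
  bang {A} = toMor (morphism A 𝟙 ⟪ constˢ (lift idₘ) ⟫ (toΔ⁰-isMorphism A))

  applyVertex≡⊛ : ∀ A B f a → applyVertex A B f a ≡ f ⊛ a
  applyVertex≡⊛ A B f a = ≡.trans
    (value≡val B (comp 𝟙 ((A ⇒ B) ⊗ A) B (ev A B) (fun (pair 𝟙 (A ⇒ B) A) (point (A ⇒ B) f , point A a))))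
    (≡.cong val (≡.trans
      (toMor-comp 𝟙 ((A ⇒ B) ⊗ A) B (ev A B) (fun (pair 𝟙 (A ⇒ B) A) (point (A ⇒ B) f , point A a)))
      (≡.cong (eval ∘_) (≡.trans (toMor-pair 𝟙 (A ⇒ B) A (point (A ⇒ B) f) (point A a))
        (≡.cong₂ ⟨_,_⟩ (toMor-point (A ⇒ B) f) (toMor-point A a))))))

  transpose≡val-Λ : ∀ A B h → transpose A B h ≡ val (Λ (toMor h))
  transpose≡val-Λ A B h = ≡.trans (value≡val (A ⇒ B) (fun (curry 𝟙 A B) h))
    (≡.cong val (toMor-curry 𝟙 A B h))

  -- The interpretation of λ-terms

  module Soundness (K : Object) (F : ∣ Hom K (K ⇒ K) ∣) (G : ∣ Hom (K ⇒ K) K ∣)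
    (isKan : IsKan (U K)) (isRetraction : IsRetraction 𝒞 cartesianClosed K F G)
    (enoughPoints : HasEnoughPoints 𝒞 cartesianClosed K) where

    open Interpretation 𝒞 cartesianClosed K F G

    𝐅 : Mor K (K ⇒ K)
    𝐅 = toMor F

    𝐆 : Mor (K ⇒ K) K
    𝐆 = toMor G

    -- Defining equations of polynomials

    look : ∀ Γ → ℕ → Assignment → Mor (K^ Γ) K
    look Γ y ρ = toMor (lookup Γ y ρ)

    poly : ∀ Γ → Term → Assignment → Mor (K^ Γ) K
    poly Γ M ρ = toMor (polynomial Γ M ρ)

    look-≡ : ∀ x Γ ρ → look (x ∷ Γ) x ρ ≡ snd
    look-≡ x Γ ρ = ≡.cong toMor (≡.cong
      (if_then π₂ (K^ Γ) K else comp (K^ Γ ⊗ K) (K^ Γ) K (lookup Γ x ρ) (π₁ (K^ Γ) K))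
      (dec-true (x ≟ x) ≡.refl))

    look-≢ : ∀ {x y} Γ ρ → y ≢ x → look (x ∷ Γ) y ρ ≡ look Γ y ρ ∘ fst
    look-≢ {x} {y} Γ ρ y≢x = ≡.trans
      (≡.cong toMor (≡.cong
        (if_then π₂ (K^ Γ) K else comp (K^ Γ ⊗ K) (K^ Γ) K (lookup Γ y ρ) (π₁ (K^ Γ) K))
        (dec-false (y ≟ x) y≢x)))
      (toMor-comp (K^ Γ ⊗ K) (K^ Γ) K (lookup Γ y ρ) (π₁ (K^ Γ) K))

    poly-· : ∀ Γ M N ρ → poly Γ (M · N) ρ ≡ eval ∘ ⟨ 𝐅 ∘ poly Γ M ρ , poly Γ N ρ ⟩
    poly-· Γ M N ρ = ≡.trans
      (toMor-comp (K^ Γ) ((K ⇒ K) ⊗ K) K (ev K K)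
        (fun (pair (K^ Γ) (K ⇒ K) K) (comp (K^ Γ) K (K ⇒ K) F (polynomial Γ M ρ) , polynomial Γ N ρ)))
      (≡.cong (eval ∘_) (≡.trans
        (toMor-pair (K^ Γ) (K ⇒ K) K (comp (K^ Γ) K (K ⇒ K) F (polynomial Γ M ρ)) (polynomial Γ N ρ))
        (≡.cong ⟨_, poly Γ N ρ ⟩ (toMor-comp (K^ Γ) K (K ⇒ K) F (polynomial Γ M ρ)))))

    poly-ƛ : ∀ Γ x M ρ → poly Γ (ƛ x M) ρ ≡ 𝐆 ∘ Λ (poly (x ∷ Γ) M ρ)
    poly-ƛ Γ x M ρ = ≡.trans
      (toMor-comp (K^ Γ) (K ⇒ K) K G (fun (curry (K^ Γ) K K) (polynomial (x ∷ Γ) M ρ)))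
      (≡.cong (𝐆 ∘_) (toMor-curry (K^ Γ) K K (polynomial (x ∷ Γ) M ρ)))

    •-≡ : ∀ a b → a • b ≡ app 𝐅 a ⊛ b
    •-≡ a b = ≡.trans (applyVertex≡⊛ K K (apply K (K ⇒ K) F a) b)
      (≡.cong (_⊛ b) (apply≡app K (K ⇒ K) F a))

    abstraction-≡ : ∀ x M ρ → abstraction x M ρ ≡ val (Λ (poly (x ∷ []) M ρ))
    abstraction-≡ x M ρ = transpose≡val-Λ K K (polynomial (x ∷ []) M ρ)

    ⟦ƛ⟧-≡ : ∀ x M ρ → ⟦ ƛ x M ⟧ ρ ≡ app 𝐆 (val (Λ (poly (x ∷ []) M ρ)))
    ⟦ƛ⟧-≡ x M ρ = ≡.trans (apply≡app (K ⇒ K) K G (abstraction x M ρ))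
      (≡.cong (app 𝐆) (abstraction-≡ x M ρ))

    𝐅∘𝐆≃id : 𝐅 ∘ 𝐆 ≃ id
    𝐅∘𝐆≃id = ≡.subst₂ _≃_ (toMor-comp (K ⇒ K) K (K ⇒ K) F G) (toMor-identity (K ⇒ K)) (toMor-≃ isRetraction)

    private
      variable
        Γ Γ′ : List ℕ

    -- Polynomials under reindexing and substitution

    look-≡-×id : ∀ x Γ ρ (t : Mor A (K^ Γ)) → look (x ∷ Γ) x ρ ∘ t ×id ≃ snd
    look-≡-×id x Γ ρ t = ≃.trans (≃.reflexive (≡.cong (_∘ t ×id) (look-≡ x Γ ρ))) (snd-⟨⟩ (t ∘ fst) snd)

    look-≢-×id : ∀ {x y} Γ ρ (t : Mor A (K^ Γ)) → y ≢ x →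
      look (x ∷ Γ) y ρ ∘ t ×id ≃ (look Γ y ρ ∘ t) ∘ fst
    look-≢-×id {x = x} {y} Γ ρ t y≢x = begin
      look (x ∷ Γ) y ρ ∘ t ×id          ≡⟨ ≡.cong (_∘ t ×id) (look-≢ Γ ρ y≢x) ⟩
      (look Γ y ρ ∘ fst) ∘ t ×id        ≈⟨ ∘-assoc _ fst (t ×id) ⟩
      look Γ y ρ ∘ (fst ∘ t ×id)        ≈⟨ ∘-congˡ (fst-⟨⟩ (t ∘ fst) snd) ⟩
      look Γ y ρ ∘ (t ∘ fst)            ≈⟨ ∘-assoc _ t fst ⟨
      (look Γ y ρ ∘ t) ∘ fst            ∎
      where open ≃-Reasoning

    poly-·-∘ : ∀ Γ M N ρ (t : Mor A (K^ Γ)) → poly Γ (M · N) ρ ∘ t ≃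
      eval ∘ ⟨ 𝐅 ∘ (poly Γ M ρ ∘ t) , poly Γ N ρ ∘ t ⟩
    poly-·-∘ Γ M N ρ t = begin
      poly Γ (M · N) ρ ∘ t                               ≡⟨ ≡.cong (_∘ t) (poly-· Γ M N ρ) ⟩
      (eval ∘ ⟨ 𝐅 ∘ poly Γ M ρ , poly Γ N ρ ⟩) ∘ t      ≈⟨ ∘-assoc eval _ t ⟩
      eval ∘ (⟨ 𝐅 ∘ poly Γ M ρ , poly Γ N ρ ⟩ ∘ t)      ≈⟨ ∘-congˡ (⟨⟩-∘ _ _ t) ⟩
      eval ∘ ⟨ (𝐅 ∘ poly Γ M ρ) ∘ t , poly Γ N ρ ∘ t ⟩  ≈⟨ ∘-congˡ (⟨⟩-cong (∘-assoc 𝐅 _ t) ≃.refl) ⟩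
      eval ∘ ⟨ 𝐅 ∘ (poly Γ M ρ ∘ t) , poly Γ N ρ ∘ t ⟩  ∎
      where open ≃-Reasoning

    poly-ƛ-∘ : ∀ Γ x M ρ (t : Mor A (K^ Γ)) → poly Γ (ƛ x M) ρ ∘ t ≃
      𝐆 ∘ Λ (poly (x ∷ Γ) M ρ ∘ t ×id)
    poly-ƛ-∘ Γ x M ρ t = begin
      poly Γ (ƛ x M) ρ ∘ t                ≡⟨ ≡.cong (_∘ t) (poly-ƛ Γ x M ρ) ⟩
      (𝐆 ∘ Λ (poly (x ∷ Γ) M ρ)) ∘ t      ≈⟨ ∘-assoc 𝐆 _ t ⟩
      𝐆 ∘ (Λ (poly (x ∷ Γ) M ρ) ∘ t)      ≈⟨ ∘-congˡ (Λ-∘ _ t) ⟩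
      𝐆 ∘ Λ (poly (x ∷ Γ) M ρ ∘ t ×id)    ∎
      where open ≃-Reasoning

    -- Contexts and assignments may both change, provided `t` matches the free variables. This
    -- covers weakening, with `t` a projection, as well as evaluation at a point, with `t` a
    -- section.
    poly-reindex : ∀ M {ρ ρ′} (t : Mor (K^ Γ) (K^ Γ′)) →
      (∀ {y} → y ∈ FV M → look Γ′ y ρ′ ∘ t ≃ look Γ y ρ) → poly Γ′ M ρ′ ∘ t ≃ poly Γ M ρ
    poly-reindex (var y) t agree = agree (here ≡.refl)
    poly-reindex {Γ} {Γ′} (M · N) {ρ} {ρ′} t agree = begin
      poly Γ′ (M · N) ρ′ ∘ t                                ≈⟨ poly-·-∘ Γ′ M N ρ′ t ⟩
      eval ∘ ⟨ 𝐅 ∘ (poly Γ′ M ρ′ ∘ t) , poly Γ′ N ρ′ ∘ t ⟩  ≈⟨ ∘-congˡ (⟨⟩-cong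
        (∘-congˡ (poly-reindex {Γ} {Γ′} M t (λ y∈M → agree (∈-++⁺ˡ y∈M))))
        (poly-reindex {Γ} {Γ′} N t (λ y∈N → agree (∈-++⁺ʳ (FV M) y∈N)))) ⟩
      eval ∘ ⟨ 𝐅 ∘ poly Γ M ρ , poly Γ N ρ ⟩                ≡⟨ poly-· Γ M N ρ ⟨
      poly Γ (M · N) ρ                                      ∎
      where open ≃-Reasoning
    poly-reindex {Γ} {Γ′} (ƛ x M) {ρ} {ρ′} t agree = begin
      poly Γ′ (ƛ x M) ρ′ ∘ t                ≈⟨ poly-ƛ-∘ Γ′ x M ρ′ t ⟩
      𝐆 ∘ Λ (poly (x ∷ Γ′) M ρ′ ∘ t ×id)
        ≈⟨ ∘-congˡ (Λ-cong (poly-reindex {x ∷ Γ} {x ∷ Γ′} M (t ×id) agree-×id)) ⟩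
      𝐆 ∘ Λ (poly (x ∷ Γ) M ρ)              ≡⟨ poly-ƛ Γ x M ρ ⟨
      poly Γ (ƛ x M) ρ                      ∎
      where
      open ≃-Reasoning
      -- The bound variable is read by `snd` on both sides; any other variable of `M` is free in
      -- `ƛ x M`, so the given agreement applies after `fst`.
      agree-×id : ∀ {y} → y ∈ FV M → look (x ∷ Γ′) y ρ′ ∘ t ×id ≃ look (x ∷ Γ) y ρ
      agree-×id {y} y∈M = cases (y ≟ x)
        where
        cases : Dec (y ≡ x) → look (x ∷ Γ′) y ρ′ ∘ t ×id ≃ look (x ∷ Γ) y ρ
        cases (yes ≡.refl) = ≃.trans (look-≡-×id x Γ′ ρ′ t) (≃.sym (≃.reflexive (look-≡ x Γ ρ)))
        cases (no y≢x)     = begin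
          look (x ∷ Γ′) y ρ′ ∘ t ×id  ≈⟨ look-≢-×id Γ′ ρ′ t y≢x ⟩
          (look Γ′ y ρ′ ∘ t) ∘ fst    ≈⟨ ∘-congʳ (agree (FV-ƛ M y∈M y≢x)) ⟩
          look Γ y ρ ∘ fst            ≡⟨ look-≢ Γ ρ y≢x ⟨
          look (x ∷ Γ) y ρ            ∎

    poly-weaken : ∀ {x} Γ M ρ → x ∉ FV M → poly (x ∷ Γ) M ρ ≃ poly Γ M ρ ∘ fst
    poly-weaken {x} Γ M ρ x∉M = ≃.sym (poly-reindex {x ∷ Γ} {Γ} M fst λ y∈M →
      ≃.sym (≃.reflexive (look-≢ Γ ρ λ { ≡.refl → x∉M y∈M })))

    -- Varying `s` and `t` together lets the induction pass under a binder: the contexts gain `x` on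
    -- one side and the renamed `z` on the other, while both sides gain one factor `K`.
    poly-substitute : ∀ M s {ρ ρ′} (t : Mor (K^ Γ) (K^ Γ′)) →
      (∀ {y} → y ∈ FV M → look Γ′ y ρ′ ∘ t ≃ poly Γ (s y) ρ) →
      poly Γ′ M ρ′ ∘ t ≃ poly Γ (substitute s M) ρ
    poly-substitute (var y) s t agree = agree (here ≡.refl)
    poly-substitute {Γ} {Γ′} (M · N) s {ρ} {ρ′} t agree = begin
      poly Γ′ (M · N) ρ′ ∘ t                                        ≈⟨ poly-·-∘ Γ′ M N ρ′ t ⟩
      eval ∘ ⟨ 𝐅 ∘ (poly Γ′ M ρ′ ∘ t) , poly Γ′ N ρ′ ∘ t ⟩          ≈⟨ ∘-congˡ (⟨⟩-cong
        (∘-congˡ (poly-substitute {Γ} {Γ′} M s t (λ y∈M → agree (∈-++⁺ˡ y∈M))))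
        (poly-substitute {Γ} {Γ′} N s t (λ y∈N → agree (∈-++⁺ʳ (FV M) y∈N)))) ⟩
      eval ∘ ⟨ 𝐅 ∘ poly Γ (substitute s M) ρ , poly Γ (substitute s N) ρ ⟩
        ≡⟨ poly-· Γ (substitute s M) (substitute s N) ρ ⟨
      poly Γ (substitute s (M · N)) ρ                               ∎
      where open ≃-Reasoning
    poly-substitute {Γ} {Γ′} (ƛ x M) s {ρ} {ρ′} t agree = begin
      poly Γ′ (ƛ x M) ρ′ ∘ t                        ≈⟨ poly-ƛ-∘ Γ′ x M ρ′ t ⟩
      𝐆 ∘ Λ (poly (x ∷ Γ′) M ρ′ ∘ t ×id)
        ≈⟨ ∘-congˡ (Λ-cong (poly-substitute {z ∷ Γ} {x ∷ Γ′} M s′ (t ×id) agree-×id)) ⟩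
      𝐆 ∘ Λ (poly (z ∷ Γ) (substitute s′ M) ρ)      ≡⟨ poly-ƛ Γ z (substitute s′ M) ρ ⟨
      poly Γ (substitute s (ƛ x M)) ρ               ∎
      where
      open ≃-Reasoning
      captured = concatMap (FV ∘′ s) (FV (ƛ x M))
      z  = rename x captured
      s′ = s [ x ↦ var z ]
      -- `captured` collects the variables of every term that replaces a free variable of `ƛ x M`,
      -- so `z` avoids each of them and `poly-weaken` applies to `s y` below.
      z-fresh : ∀ {y} → y ∈ FV (ƛ x M) → z ∉ FV (s y)
      z-fresh y∈ z∈ = rename-fresh x captured (∈-concatMap⁺ (FV ∘′ s) (lose y∈ z∈))
      agree-×id : ∀ {y} → y ∈ FV M → look (x ∷ Γ′) y ρ′ ∘ t ×id ≃ poly (z ∷ Γ) (s′ y) ρ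
      agree-×id {y} y∈M = cases (y ≟ x)
        where
        cases : Dec (y ≡ x) → look (x ∷ Γ′) y ρ′ ∘ t ×id ≃ poly (z ∷ Γ) (s′ y) ρ
        cases (yes ≡.refl) = begin
          look (x ∷ Γ′) x ρ′ ∘ t ×id    ≈⟨ look-≡-×id x Γ′ ρ′ t ⟩
          snd                           ≡⟨ look-≡ z Γ ρ ⟨
          look (z ∷ Γ) z ρ              ≡⟨ ≡.cong (λ N → poly (z ∷ Γ) N ρ) (update-≡ s x (var z)) ⟨
          poly (z ∷ Γ) (s′ x) ρ         ∎
        cases (no y≢x)     = begin
          look (x ∷ Γ′) y ρ′ ∘ t ×id    ≈⟨ look-≢-×id Γ′ ρ′ t y≢x ⟩
          (look Γ′ y ρ′ ∘ t) ∘ fst      ≈⟨ ∘-congʳ (agree y∈ƛ) ⟩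
          poly Γ (s y) ρ ∘ fst          ≈⟨ poly-weaken Γ (s y) ρ (z-fresh y∈ƛ) ⟨
          poly (z ∷ Γ) (s y) ρ          ≡⟨ ≡.cong (λ N → poly (z ∷ Γ) N ρ) (update-≢ s (var z) y≢x) ⟨
          poly (z ∷ Γ) (s′ y) ρ         ∎
          where y∈ƛ = FV-ƛ M y∈M y≢x

    -- Polynomials at points of `K`

    opaque
      unfolding pt Mor

      points-separate : (f g : Mor K K) → (∀ a → [ U K ] app f a ≃ app g a) → f ≃ g
      points-separate = enoughPoints

    infix 4 _∼_
    _∼_ : ∣ U K ∣ → ∣ U K ∣ → Set (c ⊔ˡ e)
    a ∼ b = [ U K ] a ≃ b

    module ∼ = Setoid (≃-setoid isKan)
    module ∼-Reasoning = SetoidReasoning (≃-setoid isKan)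

    val-pt-∼ : ∀ a → val (pt K a) ∼ a
    val-pt-∼ a = ≈⇒≃ (U K) (val-pt K a)

    app∼val : ∀ (f : Mor A K) a → app f a ∼ val (f ∘ pt A a)
    app∼val f a = ≈⇒≃ (U K) (app≈val f a)

    -- `⟦_⟧` is computed on vertices and `polynomial` on morphisms; each passage through `val` is
    -- undone by `pt-val`. The abstraction case makes no recursive call, since `⟦ ƛ x M ⟧` is itself
    -- defined from the polynomial of `M`.
    poly-closed : ∀ M ρ → poly [] M ρ ≃ pt K (⟦ M ⟧ ρ)
    poly-closed (var y) ρ = ≃.reflexive (toMor-point K (ρ y))
    poly-closed (M · N) ρ = begin
      poly [] (M · N) ρ                                             ≡⟨ poly-· [] M N ρ ⟩
      eval ∘ ⟨ 𝐅 ∘ poly [] M ρ , poly [] N ρ ⟩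
        ≈⟨ ∘-congˡ (⟨⟩-cong (∘-congˡ (poly-closed M ρ)) (poly-closed N ρ)) ⟩
      eval ∘ ⟨ 𝐅 ∘ pt K (⟦ M ⟧ ρ) , pt K (⟦ N ⟧ ρ) ⟩
        ≈⟨ ∘-congˡ (⟨⟩-cong (pt-app 𝐅 (⟦ M ⟧ ρ)) ≃.refl) ⟨
      eval ∘ ⟨ pt (K ⇒ K) (app 𝐅 (⟦ M ⟧ ρ)) , pt K (⟦ N ⟧ ρ) ⟩      ≈⟨ pt-val _ ⟨
      pt K (app 𝐅 (⟦ M ⟧ ρ) ⊛ ⟦ N ⟧ ρ)
        ≡⟨ ≡.cong (pt K) (•-≡ (⟦ M ⟧ ρ) (⟦ N ⟧ ρ)) ⟨
      pt K (⟦ M · N ⟧ ρ)                                            ∎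
      where open ≃-Reasoning
    poly-closed (ƛ x M) ρ = begin
      poly [] (ƛ x M) ρ                                ≡⟨ poly-ƛ [] x M ρ ⟩
      𝐆 ∘ Λ (poly (x ∷ []) M ρ)                        ≈⟨ ∘-congˡ (pt-val _) ⟨
      𝐆 ∘ pt (K ⇒ K) (val (Λ (poly (x ∷ []) M ρ)))     ≈⟨ pt-app 𝐆 _ ⟨
      pt K (app 𝐆 (val (Λ (poly (x ∷ []) M ρ))))       ≡⟨ ≡.cong (pt K) (⟦ƛ⟧-≡ x M ρ) ⟨
      pt K (⟦ ƛ x M ⟧ ρ)                               ∎
      where open ≃-Reasoning

    -- Reindexing along `⟨ id , pt K d ⟩` from the empty context moves the value of `x` from the
    -- context into the assignment.
    poly-at : ∀ x M ρ d → poly (x ∷ []) M ρ ∘ ⟨ id , pt K d ⟩ ≃ pt K (⟦ M ⟧ (ρ [ x ↦ d ]))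
    poly-at x M ρ d = ≃.trans (poly-reindex {[]} {x ∷ []} M ⟨ id , pt K d ⟩ (λ {y} _ → agree (y ≟ x)))
      (poly-closed M (ρ [ x ↦ d ]))
      where
      open ≃-Reasoning
      agree : ∀ {y} → Dec (y ≡ x) → look (x ∷ []) y ρ ∘ ⟨ id , pt K d ⟩ ≃ look [] y (ρ [ x ↦ d ])
      agree {y} (no y≢x) = begin
        look (x ∷ []) y ρ ∘ ⟨ id , pt K d ⟩        ≡⟨ ≡.cong (_∘ ⟨ id , pt K d ⟩) (look-≢ [] ρ y≢x) ⟩
        (look [] y ρ ∘ fst) ∘ ⟨ id , pt K d ⟩      ≈⟨ ∘-assoc _ fst _ ⟩
        look [] y ρ ∘ (fst ∘ ⟨ id , pt K d ⟩)      ≈⟨ ∘-congˡ (fst-⟨⟩ id (pt K d)) ⟩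
        look [] y ρ ∘ id                           ≈⟨ ∘-identityʳ _ ⟩
        look [] y ρ                                ≡⟨ ≡.cong (λ a → toMor (point K a)) (update-≢ ρ d y≢x) ⟨
        look [] y (ρ [ x ↦ d ])                    ∎
      agree (yes ≡.refl) = begin
        look (x ∷ []) x ρ ∘ ⟨ id , pt K d ⟩        ≡⟨ ≡.cong (_∘ ⟨ id , pt K d ⟩) (look-≡ x [] ρ) ⟩
        snd ∘ ⟨ id , pt K d ⟩                      ≈⟨ snd-⟨⟩ id (pt K d) ⟩
        pt K d                                     ≡⟨ ≡.cong (pt K) (update-≡ ρ x d) ⟨
        pt K ((ρ [ x ↦ d ]) x)                     ≡⟨ toMor-point K _ ⟨
        look [] x (ρ [ x ↦ d ])                    ∎

    -- Abstraction vertices and the β-law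

    abstraction-⊛ : ∀ x M ρ d → val (Λ (poly (x ∷ []) M ρ)) ⊛ d ∼ ⟦ M ⟧ (ρ [ x ↦ d ])
    abstraction-⊛ x M ρ d = ∼.trans (val-cong eval-abstraction) (val-pt-∼ _)
      where
      open ≃-Reasoning
      eval-abstraction : eval ∘ ⟨ pt (K ⇒ K) (val (Λ (poly (x ∷ []) M ρ))) , pt K d ⟩ ≃ pt K (⟦ M ⟧ (ρ [ x ↦ d ]))
      eval-abstraction = begin
        eval ∘ ⟨ pt (K ⇒ K) (val (Λ (poly (x ∷ []) M ρ))) , pt K d ⟩  ≈⟨ ∘-congˡ (⟨⟩-cong (pt-val _) ≃.refl) ⟩
        eval ∘ ⟨ Λ (poly (x ∷ []) M ρ) , pt K d ⟩                     ≈⟨ eval-Λ _ (pt K d) ⟩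
        poly (x ∷ []) M ρ ∘ ⟨ id , pt K d ⟩                           ≈⟨ poly-at x M ρ d ⟩
        pt K (⟦ M ⟧ (ρ [ x ↦ d ]))                                    ∎

    abstraction-correct : AbstractionCorrect
    abstraction-correct x M ρ d = begin
      applyVertex K K (abstraction x M ρ) d   ≡⟨ applyVertex≡⊛ K K (abstraction x M ρ) d ⟩
      abstraction x M ρ ⊛ d                   ≡⟨ ≡.cong (_⊛ d) (abstraction-≡ x M ρ) ⟩
      val (Λ (poly (x ∷ []) M ρ)) ⊛ d         ≈⟨ abstraction-⊛ x M ρ d ⟩
      ⟦ M ⟧ (ρ [ x ↦ d ])                     ∎
      where open ∼-Reasoning

    -- Stated for points rather than vertices because `_⊛_` uses its arguments through `pt`, and
    -- because `Hom 𝟙 (K ⇒ K)` is Kan whereas `U (K ⇒ K)` is not assumed to be.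
    pt-𝐅𝐆 : ∀ f → pt (K ⇒ K) (app 𝐅 (app 𝐆 f)) ≃ pt (K ⇒ K) f
    pt-𝐅𝐆 f = begin
      pt (K ⇒ K) (app 𝐅 (app 𝐆 f))     ≈⟨ pt-app 𝐅 (app 𝐆 f) ⟩
      𝐅 ∘ pt K (app 𝐆 f)               ≈⟨ ∘-congˡ (pt-app 𝐆 f) ⟩
      𝐅 ∘ (𝐆 ∘ pt (K ⇒ K) f)           ≈⟨ ∘-assoc 𝐅 𝐆 _ ⟨
      (𝐅 ∘ 𝐆) ∘ pt (K ⇒ K) f           ≈⟨ ∘-congʳ 𝐅∘𝐆≃id ⟩
      id ∘ pt (K ⇒ K) f                ≈⟨ ∘-identityˡ _ ⟩
      pt (K ⇒ K) f                     ∎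
      where open ≃-Reasoning

    ⟦ƛ⟧-β : ∀ x M ρ a → ⟦ ƛ x M ⟧ ρ • a ∼ ⟦ M ⟧ (ρ [ x ↦ a ])
    ⟦ƛ⟧-β x M ρ a = begin
      ⟦ ƛ x M ⟧ ρ • a                                       ≡⟨ •-≡ (⟦ ƛ x M ⟧ ρ) a ⟩
      app 𝐅 (⟦ ƛ x M ⟧ ρ) ⊛ a                               ≡⟨ ≡.cong (λ b → app 𝐅 b ⊛ a) (⟦ƛ⟧-≡ x M ρ) ⟩
      app 𝐅 (app 𝐆 (val (Λ (poly (x ∷ []) M ρ)))) ⊛ a       ≈⟨ val-cong (∘-congˡ (⟨⟩-cong (pt-𝐅𝐆 _) ≃.refl)) ⟩
      val (Λ (poly (x ∷ []) M ρ)) ⊛ a                       ≈⟨ abstraction-⊛ x M ρ a ⟩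
      ⟦ M ⟧ (ρ [ x ↦ a ])                                   ∎
      where open ∼-Reasoning

    -- α-conversion and the ξ-rule

    ⟦ƛ⟧-∼ : ∀ x M ρ → ⟦ ƛ x M ⟧ ρ ∼ val (𝐆 ∘ Λ (poly (x ∷ []) M ρ))
    ⟦ƛ⟧-∼ x M ρ = begin
      ⟦ ƛ x M ⟧ ρ                            ≡⟨ ⟦ƛ⟧-≡ x M ρ ⟩
      app 𝐆 (val (Λ (poly (x ∷ []) M ρ)))    ≈⟨ app∼val 𝐆 _ ⟩
      val (𝐆 ∘ pt (K ⇒ K) (val (Λ (poly (x ∷ []) M ρ))))  ≈⟨ val-cong (∘-congˡ (pt-val _)) ⟩
      val (𝐆 ∘ Λ (poly (x ∷ []) M ρ))        ∎
      where open ∼-Reasoning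

    -- The object `K^ (x ∷ [])` does not depend on `x`, so polynomials with different binders can be
    -- compared. This serves both α and ξ.
    ⟦ƛ⟧-cong : ∀ x y M N ρ → poly (x ∷ []) M ρ ≃ poly (y ∷ []) N ρ → ⟦ ƛ x M ⟧ ρ ∼ ⟦ ƛ y N ⟧ ρ
    ⟦ƛ⟧-cong x y M N ρ p≃q = begin
      ⟦ ƛ x M ⟧ ρ                            ≈⟨ ⟦ƛ⟧-∼ x M ρ ⟩
      val (𝐆 ∘ Λ (poly (x ∷ []) M ρ))        ≈⟨ val-cong (∘-congˡ (Λ-cong p≃q)) ⟩
      val (𝐆 ∘ Λ (poly (y ∷ []) N ρ))        ≈⟨ ⟦ƛ⟧-∼ y N ρ ⟨
      ⟦ ƛ y N ⟧ ρ                            ∎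
      where open ∼-Reasoning

    -- The substitution lemma along `id`, as both one-variable contexts denote `𝟙 ⊗ K`. Freshness of
    -- `y` ensures that no other free variable of `M` is read from the context.
    ⟦⟧-α-∼ : ∀ x y M ρ → y ∉ FV M → ⟦ ƛ x M ⟧ ρ ∼ ⟦ ƛ y (M [ var y / x ]) ⟧ ρ
    ⟦⟧-α-∼ x y M ρ y∉M = ⟦ƛ⟧-cong x y M (M [ var y / x ]) ρ
      (≃.trans (≃.sym (∘-identityʳ _)) (poly-substitute {y ∷ []} {x ∷ []} M (var [ x ↦ var y ]) id agree))
      where
      open ≃-Reasoning
      agree : ∀ {z} → z ∈ FV M → look (x ∷ []) z ρ ∘ id ≃ poly (y ∷ []) ((var [ x ↦ var y ]) z) ρ
      agree {z} z∈M = ≃.trans (∘-identityʳ _) (cases (z ≟ x))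
        where
        cases : Dec (z ≡ x) → look (x ∷ []) z ρ ≃ poly (y ∷ []) ((var [ x ↦ var y ]) z) ρ
        cases (yes ≡.refl) = begin
          look (x ∷ []) x ρ                                  ≡⟨ look-≡ x [] ρ ⟩
          snd                                                ≡⟨ look-≡ y [] ρ ⟨
          look (y ∷ []) y ρ
            ≡⟨ ≡.cong (λ N → poly (y ∷ []) N ρ) (update-≡ var x (var y)) ⟨
          poly (y ∷ []) ((var [ x ↦ var y ]) x) ρ            ∎
        cases (no z≢x) = begin
          look (x ∷ []) z ρ                                  ≡⟨ look-≢ [] ρ z≢x ⟩
          look [] z ρ ∘ fst                                  ≡⟨ look-≢ [] ρ (λ { ≡.refl → y∉M z∈M }) ⟨
          look (y ∷ []) z ρ
            ≡⟨ ≡.cong (λ N → poly (y ∷ []) N ρ) (update-≢ var (var y) z≢x) ⟨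
          poly (y ∷ []) ((var [ x ↦ var y ]) z) ρ            ∎

    Mor-𝟙⊗-ext : (p q : Mor (𝟙 ⊗ K) K) →
      (∀ d → val (p ∘ ⟨ id , pt K d ⟩) ∼ val (q ∘ ⟨ id , pt K d ⟩)) → p ≃ q
    Mor-𝟙⊗-ext p q p∼q = begin
      p                 ≈⟨ restrict p ⟨
      (p ∘ j) ∘ snd     ≈⟨ ∘-congʳ (points-separate (p ∘ j) (q ∘ j) p∘j∼q∘j) ⟩
      (q ∘ j) ∘ snd     ≈⟨ restrict q ⟩
      q                 ∎
      where
      open ≃-Reasoning
      -- Enough points is about K, which is equivalent to 𝟙 ⊗ K through j.
      j : Mor K (𝟙 ⊗ K)
      j = ⟨ bang , id ⟩
      -- `j ∘ snd` is homotopic to the identity: its first component is forced because `𝟙` is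
      -- terminal.
      restrict : (r : Mor (𝟙 ⊗ K) K) → (r ∘ j) ∘ snd ≃ r
      restrict r = begin
        (r ∘ j) ∘ snd                    ≈⟨ ∘-assoc r j snd ⟩
        r ∘ (j ∘ snd)                    ≈⟨ ∘-congˡ (⟨⟩-∘ bang id snd) ⟩
        r ∘ ⟨ bang ∘ snd , id ∘ snd ⟩    ≈⟨ ∘-congˡ (⟨⟩-cong (𝟙-unique _ fst) (∘-identityˡ snd)) ⟩
        r ∘ ⟨ fst , snd ⟩                ≈⟨ ∘-congˡ ⟨fst,snd⟩ ⟩
        r ∘ id                           ≈⟨ ∘-identityʳ r ⟩
        r                                ∎
      at-pt : (r : Mor (𝟙 ⊗ K) K) → ∀ d → (r ∘ j) ∘ pt K d ≃ r ∘ ⟨ id , pt K d ⟩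
      at-pt r d = begin
        (r ∘ j) ∘ pt K d                          ≈⟨ ∘-assoc r j (pt K d) ⟩
        r ∘ (j ∘ pt K d)                          ≈⟨ ∘-congˡ (⟨⟩-∘ bang id (pt K d)) ⟩
        r ∘ ⟨ bang ∘ pt K d , id ∘ pt K d ⟩
          ≈⟨ ∘-congˡ (⟨⟩-cong (𝟙-unique _ id) (∘-identityˡ (pt K d))) ⟩
        r ∘ ⟨ id , pt K d ⟩                       ∎
      app∼ : (r : Mor (𝟙 ⊗ K) K) → ∀ d → app (r ∘ j) d ∼ val (r ∘ ⟨ id , pt K d ⟩)
      app∼ r d = ∼.trans (app∼val (r ∘ j) d) (val-cong (at-pt r d))
      p∘j∼q∘j : ∀ d → app (p ∘ j) d ∼ app (q ∘ j) d
      p∘j∼q∘j d = ∼.trans (app∼ p d) (∼.trans (p∼q d) (∼.sym (app∼ q d)))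

    -- By `poly-at` the hypothesis says that the two polynomials agree at every point, and enough
    -- points then identifies them as morphisms.
    ⟦⟧-ξ-∼ : ∀ x M N ρ → (∀ a → ⟦ M ⟧ (ρ [ x ↦ a ]) ∼ ⟦ N ⟧ (ρ [ x ↦ a ])) → ⟦ ƛ x M ⟧ ρ ∼ ⟦ ƛ x N ⟧ ρ
    ⟦⟧-ξ-∼ x M N ρ M∼N = ⟦ƛ⟧-cong x x M N ρ (Mor-𝟙⊗-ext _ _ λ d →
      ∼.trans (val-poly M d) (∼.trans (M∼N d) (∼.sym (val-poly N d))))
      where
      val-poly : ∀ M d → val (poly (x ∷ []) M ρ ∘ ⟨ id , pt K d ⟩) ∼ ⟦ M ⟧ (ρ [ x ↦ d ])
      val-poly M d = ∼.trans (val-cong (poly-at x M ρ d)) (val-pt-∼ _)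

    ⟦⟧-η : ∀ x M ρ → x ∉ FV M → ⟦ ƛ x (M · var x) ⟧ ρ ∼ app (𝐆 ∘ 𝐅) (⟦ M ⟧ ρ)
    ⟦⟧-η x M ρ x∉M = begin
      ⟦ ƛ x (M · var x) ⟧ ρ                          ≈⟨ ⟦ƛ⟧-∼ x (M · var x) ρ ⟩
      val (𝐆 ∘ Λ (poly (x ∷ []) (M · var x) ρ))      ≈⟨ val-cong (∘-congˡ (Λ-cong poly-η)) ⟩
      val (𝐆 ∘ Λ (eval ∘ (𝐅 ∘ pt K (⟦ M ⟧ ρ)) ×id))  ≈⟨ val-cong (∘-congˡ (Λ-η _)) ⟩
      val (𝐆 ∘ (𝐅 ∘ pt K (⟦ M ⟧ ρ)))                 ≈⟨ val-cong (∘-assoc 𝐆 𝐅 _) ⟨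
      val ((𝐆 ∘ 𝐅) ∘ pt K (⟦ M ⟧ ρ))                 ≈⟨ app∼val (𝐆 ∘ 𝐅) (⟦ M ⟧ ρ) ⟨
      app (𝐆 ∘ 𝐅) (⟦ M ⟧ ρ)                          ∎
      where
      open ∼-Reasoning
      -- Since `x` is not free in `M`, weakening makes the operator part factor through `fst`. What
      -- remains is the uncurried form that `Λ-η` cancels.
      poly-η : poly (x ∷ []) (M · var x) ρ ≃ eval ∘ (𝐅 ∘ pt K (⟦ M ⟧ ρ)) ×id
      poly-η = R.begin
        poly (x ∷ []) (M · var x) ρ                                R.≡⟨ poly-· (x ∷ []) M (var x) ρ ⟩
        eval ∘ ⟨ 𝐅 ∘ poly (x ∷ []) M ρ , look (x ∷ []) x ρ ⟩
          R.≈⟨ ∘-congˡ (⟨⟩-cong (∘-congˡ (poly-weaken [] M ρ x∉M)) (≃.reflexive (look-≡ x [] ρ))) ⟩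
        eval ∘ ⟨ 𝐅 ∘ (poly [] M ρ ∘ fst) , snd ⟩
          R.≈⟨ ∘-congˡ (⟨⟩-cong (∘-assoc 𝐅 _ fst) ≃.refl) ⟨
        eval ∘ (𝐅 ∘ poly [] M ρ) ×id
          R.≈⟨ ∘-congˡ (⟨⟩-cong (∘-congʳ (∘-congˡ (poly-closed M ρ))) ≃.refl) ⟩
        eval ∘ (𝐅 ∘ pt K (⟦ M ⟧ ρ)) ×id                            R.∎
        where module R = ≃-Reasoning

    -- Strict dependence on the free variables only

    infix 4 _≈ₖ_
    _≈ₖ_ : ∣ U K ∣ → ∣ U K ∣ → Set e
    a ≈ₖ b = SSet._≈_ (U K) a b

    ⊛-cong-≈ : ∀ {f g : ∣ U (K ⇒ K) ∣} {a b} → SSet._≈_ (U (K ⇒ K)) f g → a ≈ₖ b → f ⊛ a ≈ₖ g ⊛ b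
    ⊛-cong-≈ f≈g a≈b = val-cong-≈ (∘-cong-≈ {g = eval {K}} {eval} ≈.refl
      (⟨⟩-cong-≈ (pt-cong-≈ (K ⇒ K) f≈g) (pt-cong-≈ K a≈b)))

    •-cong-≈ : ∀ {a a′ b b′} → a ≈ₖ a′ → b ≈ₖ b′ → a • b ≈ₖ a′ • b′
    •-cong-≈ a≈a′ b≈b′ = ≡.subst₂ _≈ₖ_ (≡.sym (•-≡ _ _)) (≡.sym (•-≡ _ _))
      (⊛-cong-≈ (app-cong-≈ 𝐅 a≈a′) b≈b′)

    look-cong-≈ : ∀ {x y} Γ {ρ ρ′} → (y ≢ x → look Γ y ρ ≈ look Γ y ρ′) → look (x ∷ Γ) y ρ ≈ look (x ∷ Γ) y ρ′
    look-cong-≈ {x} {y} Γ {ρ} {ρ′} ρ≈ρ′ = cases (y ≟ x)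
      where
      cases : Dec (y ≡ x) → look (x ∷ Γ) y ρ ≈ look (x ∷ Γ) y ρ′
      cases (yes ≡.refl) = ≈.reflexive (≡.trans (look-≡ x Γ ρ) (≡.sym (look-≡ x Γ ρ′)))
      cases (no y≢x)     = ≡.subst₂ _≈_ (≡.sym (look-≢ Γ ρ y≢x)) (≡.sym (look-≢ Γ ρ′ y≢x))
        (∘-cong-≈ (ρ≈ρ′ y≢x) ≈.refl)

    -- `poly-reindex` yields only homotopies. The induction is therefore repeated for `_≈_`, which
    -- composition, pairing and currying preserve because they are maps of simplicial sets.
    poly-cong-≈ : ∀ Γ M {ρ ρ′} → (∀ {y} → y ∈ FV M → look Γ y ρ ≈ look Γ y ρ′) → poly Γ M ρ ≈ poly Γ M ρ′
    poly-cong-≈ Γ (var y) ρ≈ρ′ = ρ≈ρ′ (here ≡.refl)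
    poly-cong-≈ Γ (M · N) {ρ} {ρ′} ρ≈ρ′ =
      ≡.subst₂ _≈_ (≡.sym (poly-· Γ M N ρ)) (≡.sym (poly-· Γ M N ρ′))
        (∘-cong-≈ ≈.refl (⟨⟩-cong-≈
          (∘-cong-≈ ≈.refl (poly-cong-≈ Γ M {ρ} {ρ′} (λ y∈M → ρ≈ρ′ (∈-++⁺ˡ y∈M))))
          (poly-cong-≈ Γ N {ρ} {ρ′} (λ y∈N → ρ≈ρ′ (∈-++⁺ʳ (FV M) y∈N)))))
    poly-cong-≈ Γ (ƛ x M) {ρ} {ρ′} ρ≈ρ′ =
      ≡.subst₂ _≈_ (≡.sym (poly-ƛ Γ x M ρ)) (≡.sym (poly-ƛ Γ x M ρ′))
        (∘-cong-≈ ≈.refl (Λ-cong-≈ (poly-cong-≈ (x ∷ Γ) M {ρ} {ρ′} (λ {y} y∈M →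
          look-cong-≈ {x} {y} Γ {ρ} {ρ′} (λ y≢x → ρ≈ρ′ (FV-ƛ M y∈M y≢x))))))

    ⟦⟧-cong-≈ : ∀ M ρ ρ′ → (∀ y → y ∈ FV M → ρ y ≈ₖ ρ′ y) → ⟦ M ⟧ ρ ≈ₖ ⟦ M ⟧ ρ′
    ⟦⟧-cong-≈ (var y) ρ ρ′ ρ≈ρ′ = ρ≈ρ′ y (here ≡.refl)
    ⟦⟧-cong-≈ (M · N) ρ ρ′ ρ≈ρ′ = •-cong-≈ {⟦ M ⟧ ρ} {⟦ M ⟧ ρ′} {⟦ N ⟧ ρ} {⟦ N ⟧ ρ′}
      (⟦⟧-cong-≈ M ρ ρ′ (λ y y∈M → ρ≈ρ′ y (∈-++⁺ˡ y∈M)))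
      (⟦⟧-cong-≈ N ρ ρ′ (λ y y∈N → ρ≈ρ′ y (∈-++⁺ʳ (FV M) y∈N)))
    -- An abstraction is interpreted through the polynomial of its body, so this case passes to
    -- `poly-cong-≈` in the context of `x`.
    ⟦⟧-cong-≈ (ƛ x M) ρ ρ′ ρ≈ρ′ = ≡.subst₂ _≈ₖ_ (≡.sym (⟦ƛ⟧-≡ x M ρ)) (≡.sym (⟦ƛ⟧-≡ x M ρ′))
      (app-cong-≈ 𝐆 (val-cong-≈ (Λ-cong-≈ (poly-cong-≈ (x ∷ []) M {ρ} {ρ′} λ {y} y∈M →
        look-cong-≈ {x} {y} [] {ρ} {ρ′} λ y≢x →
        ≡.subst₂ _≈_ (≡.sym (toMor-point K (ρ y))) (≡.sym (toMor-point K (ρ′ y)))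
          (pt-cong-≈ K (ρ≈ρ′ y (FV-ƛ M y∈M y≢x)))))))

    -- The model and its extensionality

    isHomotopicλModel : IsHomotopicλModel (U K) _•_ ⟦_⟧
    isHomotopicλModel = record
      { isKan  = isKan
      ; •-cong = •-cong-≈
      ; ⟦var⟧  = λ _ _ → SSet.Eq.refl (U K)
      ; ⟦·⟧    = λ _ _ _ → ∼.refl
      ; ⟦ƛ⟧    = ⟦ƛ⟧-β
      ; ⟦⟧-FV  = ⟦⟧-cong-≈
      ; ⟦⟧-α   = ⟦⟧-α-∼
      ; ⟦⟧-ξ   = ⟦⟧-ξ-∼
      }

    -- Both directions go through `⟦⟧-η`. From right to left a homotopy is evaluated at the vertex
    -- `⟦ M ⟧ ρ`; from left to right enough points lifts agreement on vertices to a homotopy.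
    extensional⇔ : IsExtensional (U K) _•_ ⟦_⟧ ⇔ ([ Hom K K ] comp K (K ⇒ K) K G F ≃ identity K)
    extensional⇔ = mk⇔ to from
      where
      app-id-∼ : ∀ a → app (id {K}) a ∼ a
      app-id-∼ a = ≈⇒≃ (U K) (app-id K a)
      to : IsExtensional (U K) _•_ ⟦_⟧ → [ Hom K K ] comp K (K ⇒ K) K G F ≃ identity K
      to extensional = fromMor-≃ (≡.subst₂ _≃_ (≡.sym (toMor-comp K (K ⇒ K) K G F)) (≡.sym (toMor-identity K))
        (points-separate (𝐆 ∘ 𝐅) id λ a → begin
          -- Under the constant assignment the variable 0 denotes the arbitrary vertex `a`; 1 is a
          -- binder distinct from it.
          app (𝐆 ∘ 𝐅) a                       ≈⟨ ⟦⟧-η 1 (var 0) (λ _ → a) (λ { (here ()) }) ⟨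
          ⟦ ƛ 1 (var 0 · var 1) ⟧ (λ _ → a)   ≈⟨ extensional 1 (var 0) (λ _ → a) (λ { (here ()) }) ⟩
          a                                   ≈⟨ app-id-∼ a ⟨
          app (id {K}) a                      ∎))
        where open ∼-Reasoning
      from : [ Hom K K ] comp K (K ⇒ K) K G F ≃ identity K → IsExtensional (U K) _•_ ⟦_⟧
      from GF≃id x M ρ x∉M = begin
        ⟦ ƛ x (M · var x) ⟧ ρ       ≈⟨ ⟦⟧-η x M ρ x∉M ⟩
        app (𝐆 ∘ 𝐅) (⟦ M ⟧ ρ)       ≈⟨ app-cong 𝐆∘𝐅≃id (⟦ M ⟧ ρ) ⟩
        app (id {K}) (⟦ M ⟧ ρ)      ≈⟨ app-id-∼ (⟦ M ⟧ ρ) ⟩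
        ⟦ M ⟧ ρ                     ∎
        where
        open ∼-Reasoning
        𝐆∘𝐅≃id : 𝐆 ∘ 𝐅 ≃ id
        𝐆∘𝐅≃id = ≡.subst₂ _≃_ (toMor-comp K (K ⇒ K) K G F) (toMor-identity K) (toMor-≃ GF≃id)

theorem2p2 :
    ∀ {c e p q : Level} (𝒞 : EmbeddedCategory c e p q) (cartesianClosed : CartesianClosed 𝒞) →
    let open EmbeddedCategory 𝒞
        open CartesianClosed cartesianClosed in
    (K : Object) → IsKan (U K) →
    (F : ∣ Hom K (K ⇒ K) ∣) (G : ∣ Hom (K ⇒ K) K ∣) →
    IsRetraction 𝒞 cartesianClosed K F G →
    HasEnoughPoints 𝒞 cartesianClosed K →
    let open Interpretation 𝒞 cartesianClosed K F G in
    AbstractionCorrect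
    × IsHomotopicλModel (U K) _•_ ⟦_⟧
    × (IsExtensional (U K) _•_ ⟦_⟧ ⇔ ([ Hom K K ] comp K (K ⇒ K) K G F ≃ identity K))
theorem2p2 𝒞 cartesianClosed K isKan F G isRetraction enoughPoints =
  abstraction-correct , isHomotopicλModel , extensional⇔
  where
  open HomotopyCategory 𝒞 cartesianClosed
  open Soundness K F G isKan isRetraction enoughPoints
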